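{- Let $p$ be an odd prime and $m\ge 1$ an integer. The cycle index of the permutation group $\mathcal{U}_{p^m}$ acting on $\mathbb{Z}_{p^m}$ is $$\mathcal{Z}_{(\mathcal{U}_{p^m},\mathbb{Z}_{p^m})}=\frac{1}{\phi(p^m)}\sum_{k=1}^{\phi(p^m)}\ \prod_{i=0}^m x_{u(i,k)}^{v(i,k)},$$ where $v(i,k)=\gcd(\phi(p^i),k)$ and $u(i,k)=\dfrac{\phi(p^i)}{v(i,k)}$.
   Context: $\phi$ is Euler's phi function. $\mathbb{Z}_n$ is the set of residues modulo $n$. $\mathcal{U}_n=\mathrm{Aut}(\mathbb{Z}_n)$ is identified with the set of residues $a$ modulo $n$ with $\gcd(a,n)=1$, where $a$ corresponds to the map $\pi_a(x)=ax \pmod n$; it acts on the $n$ points of $\mathbb{Z}_n$ by multiplication. For a permutation $\pi$ of a finite set with $N$ elements, $\mathrm{ctype}(\pi)=\prod_{i=1}^N x_i^{\lambda_i(\pi)}$, where $x_1,x_2,\dots$ are formal indeterminates and $\lambda_i(\pi)$ is the number of cycles of length $i$ (fixed points counted as cycles of length 1) in the disjoint cycle decomposition of $\pi$. The cycle index of a finite permutation group $G$ on a finite set $P$ is $\mathcal{Z}_{(G,P)}=\frac{1}{|G|}\sum_{\pi\in G}\mathrm{ctype}(\pi)$. -}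

module Defs where

open import Data.Fin.Base using (Fin; toℕ)
open import Data.Fin.Permutation using (Permutation′; permutation; _⟨$⟩ʳ_; flip; _∘ₚ_; inverseˡ)
  renaming (id to idₚ; _≈_ to _≈ₚ_)
open import Data.Fin.Properties using (any?; toℕ-injective; toℕ-fromℕ<; toℕ<n)
  renaming (_≟_ to _≟ᶠ_)
open import Data.Fin.Subset using (Subset; ∣_∣)
import Data.Bool.Properties as Bool
open import Data.List.Base
  using (List; []; _∷_; map; concatMap; filter; length; allFin; replicate; upTo; deduplicate; foldr)
open import Data.List.Membership.Propositional using (_∈_)
open import Data.List.Membership.Propositional.Properties using (∈-filter⁺; ∈-allFin)
open import Data.List.Properties using (≡-dec)
open import Data.List.Relation.Binary.Permutation.Propositional using (_↭_; ↭-sym; ↭-trans; ↭-reflexive; ↭⇒↭ₛ)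
open import Data.List.Relation.Binary.Pointwise using (Pointwise-≡⇒≡)
open import Data.List.Relation.Unary.All as All using (All; []; _∷_)
open import Data.List.Relation.Unary.All.Properties using (all-filter)
open import Data.List.Relation.Unary.AllPairs using (AllPairs; []; _∷_)
open import Data.List.Relation.Unary.Any using (Any; here; there)
open import Data.List.Relation.Unary.Sorted.TotalOrder.Properties using (↗↭↗⇒≋)
open import Data.List.Relation.Unary.Unique.Propositional using (Unique)
open import Data.List.Relation.Unary.Unique.Propositional.Properties using (filter⁺; allFin⁺)
open import Data.Integer.Base using (+_)
open import Data.Nat.Base
open import Data.Nat.Coprimality using (Coprime; coprime?; 1-coprimeTo; coprime-Bézout; coprime-divisor)
open import Data.Nat.DivMod
open import Data.Nat.Divisibility using (_∣_; ∣-trans; m∣m*n; ∣1⇒≡1; ∣n∣m%n⇒∣m; %-presˡ-∣)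
open import Data.Nat.GCD using (gcd; gcd[m,n]≢0; module Bézout)
open import Data.Nat.Primality using (Prime; prime⇒nonZero)
open import Data.Nat.Properties
  using (_≟_; ≤-decTotalOrder; ≤-totalOrder; m^n≢0; *-assoc; *-comm; *-identityˡ; *-identityʳ; *-distribˡ-+; *-distribʳ-+; +-assoc; +-comm)
open import Data.List.Sort.InsertionSort.Properties ≤-decTotalOrder using (sort-↭; sort-↗)
open import Data.List.Sort.InsertionSort.Base ≤-decTotalOrder using (sort)
open import Data.Product.Base using (Σ; ∃; _×_; _,_; proj₁; proj₂)
open import Data.Rational.Base as ℚ using (ℚ; 0ℚ; 1ℚ)
open import Data.Sum.Base using (inj₁)
open import Data.Vec.Base using (tabulate)
import Data.Vec.Properties as Vec
open import Relation.Binary.Definitions using (Decidable)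
open import Relation.Binary.PropositionalEquality
open import Relation.Nullary using (¬_; Dec; does)
open import Relation.Nullary.Decidable using (map′)

-- A monomial is the multiset of the indices of its factors, as a list up
-- to permutation: x₁² x₃ is 1 ∷ 1 ∷ 3 ∷ [].  (The index 0 is never used.)
Monomial : Set
Monomial = List ℕ

infix 9 x[_]^_

x[_]^_ : ℕ → ℕ → Monomial
x[ i ]^ e = replicate e i

∏ : {A : Set} → List A → (A → Monomial) → Monomial
∏ is f = concatMap f is

_↭?_ : Decidable (_↭_ {A = ℕ})
μ ↭? ν = map′
  (λ eq → ↭-trans (↭-sym (sort-↭ μ)) (↭-trans (↭-reflexive eq) (sort-↭ ν)))
  (λ μ↭ν → Pointwise-≡⇒≡ (↗↭↗⇒≋ ≤-totalOrder (sort-↗ μ) (sort-↗ ν)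
    (↭⇒↭ₛ (↭-trans (sort-↭ μ) (↭-trans μ↭ν (↭-sym (sort-↭ ν)))))))
  (≡-dec _≟_ (sort μ) (sort ν))

-- A formal ℚ-linear combination of monomials; a monomial may occur in
-- several terms, so polynomials are compared by _≈_ below.
Polynomial : Set
Polynomial = List (ℚ × Monomial)

coefficient : Monomial → Polynomial → ℚ
coefficient μ P = foldr ℚ._+_ 0ℚ (map proj₁ (filter (λ t → proj₂ t ↭? μ) P))

infix 4 _≈_

_≈_ : Polynomial → Polynomial → Set
P ≈ Q = ∀ μ → coefficient μ P ≡ coefficient μ Q

∑ : {A : Set} → List A → (A → Monomial) → Polynomial
∑ is f = map (λ i → 1ℚ , f i) is

infixr 7 _·_

_·_ : ℚ → Polynomial → Polynomial
c · P = map (λ (a , μ) → c ℚ.* a , μ) P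

1/ : (n : ℕ) .{{_ : NonZero n}} → ℚ
1/ n = + 1 ℚ./ n

[1⋯_] : ℕ → List ℕ
[1⋯ n ] = map suc (upTo n)

[0⋯_] : ℕ → List ℕ
[0⋯ n ] = upTo (suc n)

module _ {N : ℕ} (π : Permutation′ N) where

  infix 8 _^ₚ_

  _^ₚ_ : ℕ → Fin N → Fin N
  zero  ^ₚ x = x
  suc k ^ₚ x = π ⟨$⟩ʳ (k ^ₚ x)

  -- The support { πᵏ(x) | k ≥ 0 } of the cycle through x.  A cycle on N
  -- points has length at most N, so the exponents k < N reach all of it.
  cycleOf : Fin N → Subset N
  cycleOf x = tabulate λ y → does (any? {n = N} λ k → (toℕ k ^ₚ x) ≟ᶠ y)

  -- Disjoint cycles are determined by their supports.
  cycles : List (Subset N)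
  cycles = deduplicate (Vec.≡-dec Bool._≟_) (map cycleOf (allFin N))

  cycleCount : ℕ → ℕ
  cycleCount i = length (filter (λ c → ∣ c ∣ ≟ i) cycles)

  ctype : Monomial
  ctype = ∏ [1⋯ N ] λ i → x[ i ]^ cycleCount i

nonEmpty : ∀ {A : Set} {P : A → Set} {as} → Any P as → NonZero (length as)
nonEmpty (here _)  = _
nonEmpty (there _) = _

record PermutationGroup (N : ℕ) : Set where
  field
    elements  : List (Permutation′ N)
    distinct  : AllPairs (λ π ρ → ¬ (π ≈ₚ ρ)) elements

  infix 4 _∈G
  _∈G : Permutation′ N → Set
  π ∈G = Any (π ≈ₚ_) elements

  field
    id-closed : idₚ ∈G
    ∘-closed  : ∀ {π ρ} → π ∈G → ρ ∈G → π ∘ₚ ρ ∈G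
    ⁻¹-closed : ∀ {π} → π ∈G → flip π ∈G

  order : ℕ
  order = length elements

  instance
    order≢0 : NonZero order
    order≢0 = nonEmpty id-closed

cycleIndex : ∀ {N} → PermutationGroup N → Polynomial
cycleIndex G = 1/ order · ∑ elements ctype
  where open PermutationGroup G

module _ (n : ℕ) .{{_ : NonZero n}} where

  mul : ℕ → Fin n → Fin n
  mul a x = (a * toℕ x) mod n

  toℕ-mul : ∀ a x → toℕ (mul a x) ≡ (a * toℕ x) % n
  toℕ-mul a x = toℕ-fromℕ< _

  %-*ˡ : ∀ a b → (a % n * b) % n ≡ (a * b) % n
  %-*ˡ a b = begin
    (a % n * b) % n             ≡⟨ %-distribˡ-* (a % n) b n ⟩
    (a % n % n * (b % n)) % n   ≡⟨ cong (λ z → (z * (b % n)) % n) (m%n%n≡m%n a n) ⟩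
    (a % n * (b % n)) % n       ≡⟨ %-distribˡ-* a b n ⟨
    (a * b) % n                 ∎
    where open ≡-Reasoning

  %-*ʳ : ∀ a b → (a * (b % n)) % n ≡ (a * b) % n
  %-*ʳ a b = begin
    (a * (b % n)) % n  ≡⟨ cong (_% n) (*-comm a (b % n)) ⟩
    (b % n * a) % n    ≡⟨ %-*ˡ b a ⟩
    (b * a) % n        ≡⟨ cong (_% n) (*-comm b a) ⟩
    (a * b) % n        ∎
    where open ≡-Reasoning

  mul-∘ : ∀ a b x → mul a (mul b x) ≡ mul (a * b) x
  mul-∘ a b x = toℕ-injective (begin
    toℕ (mul a (mul b x))        ≡⟨ toℕ-mul a _ ⟩
    (a * toℕ (mul b x)) % n      ≡⟨ cong (λ z → (a * z) % n) (toℕ-mul b x) ⟩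
    (a * ((b * toℕ x) % n)) % n  ≡⟨ %-*ʳ a _ ⟩
    (a * (b * toℕ x)) % n        ≡⟨ cong (_% n) (*-assoc a b (toℕ x)) ⟨
    (a * b * toℕ x) % n          ≡⟨ toℕ-mul (a * b) x ⟨
    toℕ (mul (a * b) x)          ∎)
    where open ≡-Reasoning

  mul-cong : ∀ {a b} → a % n ≡ b % n → ∀ x → mul a x ≡ mul b x
  mul-cong {a} {b} eq x = toℕ-injective (begin
    toℕ (mul a x)          ≡⟨ toℕ-mul a x ⟩
    (a * toℕ x) % n        ≡⟨ %-*ˡ a (toℕ x) ⟨
    (a % n * toℕ x) % n    ≡⟨ cong (λ z → (z * toℕ x) % n) eq ⟩
    (b % n * toℕ x) % n    ≡⟨ %-*ˡ b (toℕ x) ⟩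
    (b * toℕ x) % n        ≡⟨ toℕ-mul b x ⟨
    toℕ (mul b x)          ∎)
    where open ≡-Reasoning

  mul-1 : ∀ x → mul 1 x ≡ x
  mul-1 x = toℕ-injective (begin
    toℕ (mul 1 x)    ≡⟨ toℕ-mul 1 x ⟩
    (1 * toℕ x) % n  ≡⟨ cong (_% n) (*-identityˡ (toℕ x)) ⟩
    toℕ x % n        ≡⟨ m<n⇒m%n≡m (toℕ<n x) ⟩
    toℕ x            ∎)
    where open ≡-Reasoning

  toℕ% : ∀ a → toℕ (a mod n) % n ≡ a % n
  toℕ% a = trans (cong (_% n) (toℕ-fromℕ< _)) (m%n%n≡m%n a n)

  inverse : ∀ a → Coprime a n → ∃ λ b → (a * b) % n ≡ 1 % n
  inverse a a⊥n with coprime-Bézout a⊥n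
  ... | Bézout.+- x y eq = x , (begin
    (a * x) % n      ≡⟨ cong (_% n) (trans (*-comm a x) (sym eq)) ⟩
    (1 + y * n) % n  ≡⟨ [m+kn]%n≡m%n 1 y n ⟩
    1 % n            ∎)
    where open ≡-Reasoning
  ... | Bézout.-+ x y eq = x * a * x , (begin
    (a * (x * a * x)) % n               ≡⟨ cong (_% n) lem ⟩
    (s * s) % n                         ≡⟨ [m+kn]%n≡m%n (s * s) (y + y) n ⟨
    (s * s + (y + y) * n) % n           ≡⟨ cong (_% n) lem₂ ⟩
    (1 + y * n * (y * n)) % n           ≡⟨ cong (λ z → (1 + z) % n) (*-assoc (y * n) y n) ⟨
    (1 + y * n * y * n) % n             ≡⟨ [m+kn]%n≡m%n 1 (y * n * y) n ⟩
    1 % n                               ∎)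
    where
    open ≡-Reasoning
    s = x * a
    lem : a * (x * a * x) ≡ s * s
    lem = trans (*-comm a (s * x)) (*-assoc s x a)
    lem₂ : s * s + (y + y) * n ≡ 1 + y * n * (y * n)
    lem₂ = begin
      s * s + (y + y) * n          ≡⟨ cong (_+_ (s * s)) (*-distribʳ-+ n y y) ⟩
      s * s + (y * n + y * n)      ≡⟨ cong (λ z → s * s + (z + z)) eq ⟨
      s * s + (suc s + suc s)      ≡⟨ +-comm (s * s) _ ⟩
      suc s + suc s + s * s        ≡⟨ cong (λ z → suc (z + s * s)) (+-comm s (suc s)) ⟩
      suc (suc s + s + s * s)      ≡⟨ cong suc (+-assoc (suc s) s (s * s)) ⟩
      suc (suc s + (s + s * s))    ≡⟨ cong (λ z → suc (suc s + z)) (*-sucʳ s) ⟩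
      1 + (suc s + s * suc s)      ≡⟨⟩
      1 + suc s * suc s            ≡⟨ cong (λ z → 1 + z * z) eq ⟩
      1 + y * n * (y * n)          ∎
      where
      *-sucʳ : ∀ s → s + s * s ≡ s * suc s
      *-sucʳ s = trans (cong (_+ s * s) (sym (*-identityʳ s))) (sym (*-distribˡ-+ s 1 s))

  ≡1⇒coprime : ∀ a {b} → (a * b) % n ≡ 1 % n → Coprime a n
  ≡1⇒coprime a {b} eq {d} (d∣a , d∣n) = ∣1⇒≡1 (∣n∣m%n⇒∣m d∣n
    (subst (d ∣_) eq (%-presˡ-∣ (∣-trans d∣a (m∣m*n b)) d∣n)))

  coprime-* : ∀ {a b} → Coprime a n → Coprime b n → Coprime (a * b) n
  coprime-* {a} a⊥n b⊥n (d∣ab , d∣n) =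
    b⊥n (coprime-divisor (λ (e∣d , e∣a) → a⊥n (e∣a , ∣-trans e∣d d∣n)) d∣ab , d∣n)

  coprime-mod : ∀ {a} → Coprime a n → Coprime (toℕ (a mod n)) n
  coprime-mod {a} a⊥n (d∣ , d∣n) =
    a⊥n (∣n∣m%n⇒∣m d∣n (subst (_ ∣_) (toℕ-fromℕ< _) d∣) , d∣n)

  π[_] : ∀ {a : Fin n} → Coprime (toℕ a) n → Permutation′ n
  π[_] {a} a⊥n = permutation (mul (toℕ a)) (mul b)
    (λ x → trans (mul-∘ (toℕ a) b x) (trans (mul-cong ab≡1 x) (mul-1 x)))
    (λ x → trans (mul-∘ b (toℕ a) x)
      (trans (mul-cong (trans (cong (_% n) (*-comm b (toℕ a))) ab≡1) x) (mul-1 x)))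
    where
    b    = proj₁ (inverse (toℕ a) a⊥n)
    ab≡1 = proj₂ (inverse (toℕ a) a⊥n)

  unit? : (a : Fin n) → Dec (Coprime (toℕ a) n)
  unit? a = coprime? (toℕ a) n

  units : List (Fin n)
  units = filter unit? (allFin n)

  unitMaps : List (Permutation′ n)
  unitMaps = All.reduce π[_] (all-filter unit? (allFin n))

  any-reduce : ∀ {A B : Set} {P : A → Set} {Q : B → Set} {f : ∀ {a} → P a → B}
               {a as} → a ∈ as → (pas : All P as) → (∀ p → Q (f {a} p)) →
               Any Q (All.reduce f pas)
  any-reduce (here refl) (pa ∷ _)   q = here (q pa)
  any-reduce (there a∈)  (_  ∷ pas) q = there (any-reduce a∈ pas q)

  any-reduce⁻ : ∀ {A B : Set} {P : A → Set} {Q : B → Set} {f : ∀ {a} → P a → B}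
                {as} (pas : All P as) → Any Q (All.reduce f pas) →
                Σ A λ a → Σ (P a) λ p → Q (f p)
  any-reduce⁻ (pa ∷ _)   (here q)  = _ , pa , q
  any-reduce⁻ (_  ∷ pas) (there q) = any-reduce⁻ pas q

  all-reduce : ∀ {A B : Set} {P : A → Set} {Q : B → Set} {R : A → Set} {f : ∀ {a} → P a → B} →
               (∀ {a} → R a → (p : P a) → Q (f p)) →
               ∀ {as} → All R as → (pas : All P as) → All Q (All.reduce f pas)
  all-reduce h []       []         = []
  all-reduce h (r ∷ rs) (pa ∷ pas) = h r pa ∷ all-reduce h rs pas

  pairs-reduce : ∀ {A B : Set} {P : A → Set} {R : B → B → Set} {f : ∀ {a} → P a → B} →
                 (∀ {a b} → a ≢ b → (p : P a) (q : P b) → R (f p) (f q)) →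
                 ∀ {as} → Unique as → (pas : All P as) → AllPairs R (All.reduce f pas)
  pairs-reduce h []       []         = []
  pairs-reduce h (u ∷ us) (pa ∷ pas) =
    all-reduce (λ a≢b q → h a≢b pa q) u pas ∷ pairs-reduce h us pas

  π-injective : ∀ {a b : Fin n} → a ≢ b → (p : Coprime (toℕ a) n) (q : Coprime (toℕ b) n) →
                ¬ (π[ p ] ≈ₚ π[ q ])
  π-injective {a} {b} a≢b _ _ eq =
    a≢b (toℕ-injective (trans (sym (at1 a)) (trans (cong toℕ (eq (1 mod n))) (at1 b))))
    where
    at1 : ∀ a → toℕ (mul (toℕ a) (1 mod n)) ≡ toℕ a
    at1 a = begin
      toℕ (mul (toℕ a) (1 mod n))    ≡⟨ toℕ-mul (toℕ a) _ ⟩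
      (toℕ a * toℕ (1 mod n)) % n    ≡⟨ cong (λ z → (toℕ a * z) % n) (toℕ-fromℕ< _) ⟩
      (toℕ a * (1 % n)) % n          ≡⟨ %-*ʳ (toℕ a) 1 ⟩
      (toℕ a * 1) % n                ≡⟨ cong (_% n) (*-identityʳ (toℕ a)) ⟩
      toℕ a % n                      ≡⟨ m<n⇒m%n≡m (toℕ<n a) ⟩
      toℕ a                          ∎
      where open ≡-Reasoning

  member : ∀ {ρ a} → Coprime a n → (∀ x → ρ ⟨$⟩ʳ x ≡ mul a x) → Any (ρ ≈ₚ_) unitMaps
  member {ρ} {a} a⊥n eq = any-reduce {Q = ρ ≈ₚ_} {f = π[_]}
    (∈-filter⁺ unit? (∈-allFin (a mod n)) (coprime-mod a⊥n))
    (all-filter unit? (allFin n))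
    (λ _ x → trans (eq x) (mul-cong (sym (toℕ% a)) x))

  member⁻ : ∀ {ρ} → Any (ρ ≈ₚ_) unitMaps → ∃ λ (a : Fin n) → Σ (Coprime (toℕ a) n) λ p → ρ ≈ₚ π[ p ]
  member⁻ {ρ} = any-reduce⁻ {Q = ρ ≈ₚ_} {f = π[_]} (all-filter unit? (allFin n))

  𝒰 : PermutationGroup n
  𝒰 = record
    { elements  = unitMaps
    ; distinct  = pairs-reduce π-injective (filter⁺ unit? (allFin⁺ n)) (all-filter unit? (allFin n))
    ; id-closed = member {idₚ} {1} (1-coprimeTo n) (λ x → sym (mul-1 x))
    ; ∘-closed  = λ {π} {ρ} → closed {π} {ρ}
    ; ⁻¹-closed = λ {π} → inv {π}
    }
    where
    closed : ∀ {π ρ} → Any (π ≈ₚ_) unitMaps → Any (ρ ≈ₚ_) unitMaps → Any (π ∘ₚ ρ ≈ₚ_) unitMaps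
    closed {π} {ρ} π∈ ρ∈ =
      let (a , p , π≈) = member⁻ {π} π∈
          (b , q , ρ≈) = member⁻ {ρ} ρ∈
      in member {π ∘ₚ ρ} {toℕ b * toℕ a} (coprime-* {toℕ b} {toℕ a} q p) λ x →
           trans (cong (ρ ⟨$⟩ʳ_) (π≈ x))
             (trans (ρ≈ (mul (toℕ a) x)) (mul-∘ (toℕ b) (toℕ a) x))

    inv : ∀ {π} → Any (π ≈ₚ_) unitMaps → Any (flip π ≈ₚ_) unitMaps
    inv {π} π∈ =
      let (a , p , π≈) = member⁻ {π} π∈
          (b , ab≡1)   = inverse (toℕ a) p
          ba≡1         = trans (cong (_% n) (*-comm b (toℕ a))) ab≡1
          πb≡id        = λ x → trans (π≈ (mul b x))
                           (trans (mul-∘ (toℕ a) b x) (trans (mul-cong ab≡1 x) (mul-1 x)))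
      in member {flip π} {b} (≡1⇒coprime b {toℕ a} ba≡1) λ x →
           trans (cong (flip π ⟨$⟩ʳ_) (sym (πb≡id x))) (inverseˡ π)

φ : ℕ → ℕ
φ n = length (filter (λ k → coprime? k n) [1⋯ n ])

φ≢0 : ∀ n .{{_ : NonZero n}} → NonZero (φ n)
φ≢0 (suc n) = nonEmpty (∈-filter⁺ (λ k → coprime? k (suc n)) {xs = [1⋯ suc n ]}
                          (here refl) (1-coprimeTo (suc n)))

prime^≢0 : ∀ {p} → Prime p → ∀ m → NonZero (p ^ m)
prime^≢0 {p} pr m = m^n≢0 p m {{prime⇒nonZero pr}}

module _ {p : ℕ} (p-prime : Prime p) where

  φ[p^_]≢0 : ∀ i → NonZero (φ (p ^ i))
  φ[p^ i ]≢0 = φ≢0 (p ^ i) {{prime^≢0 p-prime i}}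

  v : ℕ → ℕ → ℕ
  v i k = gcd (φ (p ^ i)) k

  v≢0 : ∀ i k → NonZero (v i k)
  v≢0 i k = ≢-nonZero (gcd[m,n]≢0 (φ (p ^ i)) k
              (inj₁ (≢-nonZero⁻¹ (φ (p ^ i)) {{φ[p^ i ]≢0}})))

  u : ℕ → ℕ → ℕ
  u i k = (φ (p ^ i) / v i k) {{v≢0 i k}}

{-# OPTIONS --safe #-}
module Submission where

-- There is one g which is a primitive root modulo pⁱ for every i ≤ m: the
-- product of h^(p^(m-1)), where h is a primitive root modulo p (an element of
-- order p - 1 modulo every pⁱ, i ≥ 1), and of 1 + p, which has order p^(i-1)
-- modulo pⁱ.  So 𝒰 consists of the multiplications by gᵏ, 1 ≤ k ≤ φ(pᵐ).
-- A point p^(m-i) y with y prime to p returns to itself under j-fold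
-- multiplication by gᵏ exactly if g^(kj) ≡ 1 modulo pⁱ, so it lies on a cycle
-- of length φ(pⁱ) / gcd(φ(pⁱ), k), and there are φ(pⁱ) such points.

open import Defs
import Data.Bool.Properties as Bool
open import Data.Bool.Base using (true)
open import Data.Fin.Base as Fin using (Fin; toℕ; fromℕ<)
open import Data.Fin.Permutation using (Permutation′; _⟨$⟩ʳ_; _⟨$⟩ˡ_; inverseˡ)
open import Data.Fin.Properties using (any?; toℕ-injective; toℕ-fromℕ<; toℕ<n) renaming (_≟_ to _≟ᶠ_)
open import Data.Fin.Subset using (∣_∣)
open import Data.Fin.Subset.Properties using (∣p∣≤n)
open import Data.Integer.Base as ℤ using (ℤ; 1ℤ) renaming (+_ to pos)
import Data.Integer.Properties as ℤ
open import Data.Integer.Divisibility.Signed as ℤ∣ using (∣ᵤ⇒∣; ∣⇒∣ᵤ)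
open import Data.Integer.Tactic.RingSolver using () renaming (solve-∀ to ℤ-solve-∀)
open import Data.List.Base as List
  using (List; []; _∷_; _++_; _∷ʳ_; map; foldr; filter; length; upTo; allFin; concatMap; applyUpTo; replicate)
open import Data.List.Properties
  using (length-++; filter-++; length-map; length-upTo; length-applyUpTo; length-tabulate; map-applyUpTo;
         map-tabulate; upTo-∷ʳ; concatMap-++; ++-identityʳ; length-replicate)
open import Data.List.Membership.Propositional using (_∈_; _∉_; find; lose)
open import Data.List.Membership.Propositional.Properties
  using (∈-length; ∈-∃++; ∈-map⁺; ∈-map⁻; ∈-filter⁺; ∈-filter⁻; ∈-concatMap⁺; ∈-concatMap⁻; ∈-allFin;
         ∈-upTo⁺; ∈-upTo⁻; ∈-applyUpTo⁺; ∈-applyUpTo⁻; ∈-deduplicate⁺; ∈-deduplicate⁻)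
open import Data.List.Relation.Binary.Permutation.Propositional using (_↭_; ↭-refl; ↭-sym; ↭-trans; prep)
open import Data.List.Relation.Binary.Permutation.Propositional.Properties
  using (↭-length; filter-↭; shift; ∈-resp-↭)
open import Data.List.Relation.Unary.All as All using (All; []; _∷_; all?)
import Data.List.Relation.Unary.All.Properties as All
open import Data.List.Relation.Unary.All.Properties using (¬All⇒Any¬; all-filter)
open import Data.List.Relation.Unary.AllPairs using (AllPairs; []; _∷_)
import Data.List.Relation.Unary.AllPairs.Properties as AllPairs
open import Data.List.Relation.Unary.Any using (here; there)
open import Data.List.Relation.Unary.Unique.Propositional using (Unique)
import Data.List.Relation.Unary.Unique.Propositional.Properties as Unique
import Data.List.Relation.Unary.Unique.DecPropositional.Properties as DecUnique
open import Data.Nat.Base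
open import Data.Nat.Coprimality as Coprimality using (Coprime; coprime?; coprime-divisor; prime⇒coprime)
open import Data.Nat.DivMod
open import Data.Nat.Divisibility
open import Data.Nat.GCD using (gcd; gcd-GCD; gcd-greatest; gcd[m,n]∣m; gcd[m,n]∣n; c*gcd[m,n]≡gcd[cm,cn]; module Bézout)
open import Data.Nat.Induction using (<-rec)
open import Data.Nat.ListAction using (product)
open import Data.Nat.ListAction.Properties using (product-↭)
open import Data.Nat.Primality
open import Data.Nat.Primality.Factorisation using (factorise)
open import Data.Nat.Properties
open import Data.Nat.Tactic.RingSolver using () renaming (solve-∀ to ℕ-solve-∀)
open import Data.Product.Base using (∃; _×_; _,_; proj₁; proj₂)
open import Data.Rational.Base as ℚ using (0ℚ; 1ℚ)
open import Data.Sum.Base using (_⊎_; inj₁; inj₂)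
open import Data.Vec.Base using (tabulate; lookup)
open import Data.Vec.Properties using (≡-dec; lookup∘tabulate; tabulate-cong)
open import Function.Base using (_∘_)
open import Function.Bundles using (mk⇔)
open import Level using (0ℓ)
open import Relation.Binary.PropositionalEquality
open import Relation.Nullary using (¬_; yes; no; contradiction; Dec; does)
open import Relation.Nullary.Decidable using (_⊎-dec_; does-⇔; dec-true)
open import Relation.Unary using (Pred; Decidable)


-- Counting in lists

-- The exponent of h: h^(p-1) differs from 1 by a multiple of p, and every further p-th power puts
-- at least one more factor p into the difference.
--
-- Oddness matters for 1 + p. In the p-th power of 1 + p^j c the quadratic term has to vanish modulo
-- p^(j+2), which for j = 1 and c prime to p requires p to divide p(p-1)/2.
--
-- The root h exists because x^e - 1 with 0 < e < p - 1 has fewer roots than there are nonzero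
-- residues. This yields an element of order q^j for each prime power q^j > 1 dividing p - 1, and
-- elements of coprime orders are multiplied together.
--
-- The obstacle in comparing the two sides is that the lengths u(i,k) may coincide for different i:
-- for k = φ(p^m) all of them are 1. Strata therefore cannot be matched with cycle lengths. Instead,
-- for each l > 0, l times the exponent of x_l is shown on both sides to be the number of points on
-- cycles of length l, and l is cancelled.

private variable
  A B : Set

count : {P : Pred A 0ℓ} → Decidable P → List A → ℕ
count P? xs = length (filter P? xs)

count-↭ : {P : Pred A 0ℓ} (P? : Decidable P) {xs ys : List A} → xs ↭ ys → count P? xs ≡ count P? ys
count-↭ P? = ↭-length ∘ filter-↭ P?

count-++ : {P : Pred A 0ℓ} (P? : Decidable P) (xs ys : List A) → count P? (xs ++ ys) ≡ count P? xs + count P? ys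
count-++ P? xs ys = trans (cong length (filter-++ P? xs ys)) (length-++ (filter P? xs))

count-⊎ : {P : Pred A 0ℓ} (P? : Decidable P) {Q : Pred A 0ℓ} (Q? : Decidable Q) {R : Pred A 0ℓ} (R? : Decidable R) →
          (∀ {x} → P x → R x) → (∀ {x} → Q x → R x) → (∀ {x} → R x → P x ⊎ Q x) →
          (∀ {x} → P x → ¬ Q x) → (xs : List A) →
          count R? xs ≡ count P? xs + count Q? xs
count-⊎ P? Q? R? p q r pq [] = refl
count-⊎ P? Q? R? p q r pq (x ∷ xs) with ih ← count-⊎ P? Q? R? p q r pq xs | P? x | Q? x | R? x
... | yes a | yes b | _     = contradiction b (pq a)
... | yes a | no _  | yes _ = cong suc ih
... | yes a | no _  | no c  = contradiction (p a) c
... | no _  | yes b | yes _ = trans (cong suc ih) (sym (+-suc (count P? xs) (count Q? xs)))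
... | no _  | yes b | no c  = contradiction (q b) c
... | no a  | no b  | yes c with r c
...   | inj₁ z = contradiction z a
...   | inj₂ z = contradiction z b
count-⊎ P? Q? R? p q r pq (x ∷ xs) | no _  | no _  | no _  = ih

count-map : {P : Pred A 0ℓ} (P? : Decidable P) {Q : Pred B 0ℓ} (Q? : Decidable Q) (f : A → B) (xs : List A) →
            (∀ {x} → x ∈ xs → P x → Q (f x)) → (∀ {x} → x ∈ xs → Q (f x) → P x) →
            count Q? (map f xs) ≡ count P? xs
count-map P? Q? f [] _ _ = refl
count-map P? Q? f (x ∷ xs) to from
  with ih ← count-map P? Q? f xs (to ∘ there) (from ∘ there) | P? x | Q? (f x)
... | yes _ | yes _ = cong suc ih
... | yes a | no b  = contradiction (to (here refl) a) b
... | no a  | yes b = contradiction (from (here refl) b) a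
... | no _  | no _  = ih

count-cong : {P : Pred A 0ℓ} (P? : Decidable P) {Q : Pred A 0ℓ} (Q? : Decidable Q) (xs : List A) →
             (∀ {x} → x ∈ xs → P x → Q x) → (∀ {x} → x ∈ xs → Q x → P x) →
             count P? xs ≡ count Q? xs
count-cong P? Q? [] _ _ = refl
count-cong P? Q? (x ∷ xs) to from
  with ih ← count-cong P? Q? xs (to ∘ there) (from ∘ there) | P? x | Q? x
... | yes _ | yes _ = cong suc ih
... | yes a | no b  = contradiction (to (here refl) a) b
... | no a  | yes b = contradiction (from (here refl) b) a
... | no _  | no _  = ih

count-all : {P : Pred A 0ℓ} (P? : Decidable P) (xs : List A) → (∀ {x} → x ∈ xs → P x) → count P? xs ≡ length xs
count-all P? [] _ = refl
count-all P? (x ∷ xs) p with P? x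
... | yes _ = cong suc (count-all P? xs (p ∘ there))
... | no ¬p = contradiction (p (here refl)) ¬p

count-none : {P : Pred A 0ℓ} (P? : Decidable P) (xs : List A) → (∀ {x} → x ∈ xs → ¬ P x) → count P? xs ≡ 0
count-none P? [] _ = refl
count-none P? (x ∷ xs) ¬p with P? x
... | yes p = contradiction p (¬p (here refl))
... | no  _ = count-none P? xs (¬p ∘ there)

∈⇒count>0 : {P : Pred A 0ℓ} (P? : Decidable P) {x : A} {xs : List A} → x ∈ xs → P x → 0 < count P? xs
∈⇒count>0 P? x∈ p = ∈-length (∈-filter⁺ P? x∈ p)

count>0⇒∃ : {P : Pred A 0ℓ} (P? : Decidable P) (xs : List A) → 0 < count P? xs → ∃ λ x → x ∈ xs × P x
count>0⇒∃ P? (x ∷ xs) c with P? x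
... | yes p = x , here refl , p
... | no  _ with count>0⇒∃ P? xs c
...   | y , y∈ , p = y , there y∈ , p

module _ (_≟ᴮ_ : (x y : B) → Dec (x ≡ y)) where
  open import Data.List.Membership.DecPropositional _≟ᴮ_ using (_∈?_)

  -- Double counting. It is applied to the map from points to their cycles, where each cycle of
  -- length `l` is the image of exactly `l` points.
  count-fibres : (f : A → B) (xs : List A) {l : ℕ} {bs : List B} → Unique bs →
                 (∀ {b} → b ∈ bs → count (λ x → f x ≟ᴮ b) xs ≡ l) →
                 count (λ x → f x ∈? bs) xs ≡ length bs * l
  count-fibres f xs [] _ = count-none _ xs λ _ ()
  count-fibres f xs {l} {b ∷ bs} (b∉ ∷ u) fibre = begin
    count (λ x → f x ∈? (b ∷ bs)) xs
      ≡⟨ count-⊎ (λ x → f x ≟ᴮ b) (λ x → f x ∈? bs) (λ x → f x ∈? (b ∷ bs)) here there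
           (λ { (here e) → inj₁ e ; (there e) → inj₂ e })
           (λ { refl e → All.lookup b∉ e refl }) xs ⟩
    count (λ x → f x ≟ᴮ b) xs + count (λ x → f x ∈? bs) xs
      ≡⟨ cong₂ _+_ (fibre (here refl)) (count-fibres f xs u (fibre ∘ there)) ⟩
    l + length bs * l ∎
    where open ≡-Reasoning

  -- The head of `xs` has positive multiplicity in `ys`, so it can be removed from both. Equality of
  -- monomials thus becomes one numerical equation for each index.
  ↭-counts : (xs ys : List B) → (∀ l → count (_≟ᴮ l) xs ≡ count (_≟ᴮ l) ys) → xs ↭ ys
  ↭-counts [] [] _ = ↭-refl
  ↭-counts [] (y ∷ ys) eq = contradiction (subst (0 <_) (sym (eq y)) (∈⇒count>0 (_≟ᴮ y) (here refl) refl)) λ ()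
  ↭-counts (x ∷ xs) ys eq
    with count>0⇒∃ (_≟ᴮ x) ys (subst (0 <_) (eq x) (∈⇒count>0 (_≟ᴮ x) (here refl) refl))
  ... | _ , x∈ , refl with ∈-∃++ x∈
  ...   | as , bs , refl = ↭-trans (prep x (↭-counts xs (as ++ bs) rest)) (↭-sym (shift x as bs))
    where
    eq′ : ∀ l → count (_≟ᴮ l) (x ∷ xs) ≡ count (_≟ᴮ l) (x ∷ as ++ bs)
    eq′ l = trans (eq l) (count-↭ (_≟ᴮ l) (shift x as bs))
    rest : ∀ l → count (_≟ᴮ l) xs ≡ count (_≟ᴮ l) (as ++ bs)
    rest l with x ≟ᴮ l | eq′ l
    ... | yes _ | e = suc-injective e
    ... | no _  | e = e

unique-⊆-uncons : {x : A} {xs ys : List A} → Unique (x ∷ xs) → (∀ {y} → y ∈ x ∷ xs → y ∈ ys) →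
                  ∃ λ zs → ys ↭ x ∷ zs × (∀ {y} → y ∈ xs → y ∈ zs)
unique-⊆-uncons {x = x} {xs} (x∉ ∷ _) sub with ∈-∃++ (sub (here refl))
... | as , bs , refl = as ++ bs , shift x as bs , sub′
  where
  sub′ : ∀ {y} → y ∈ xs → y ∈ as ++ bs
  sub′ y∈ with ∈-resp-↭ (shift x as bs) (sub (there y∈))
  ... | here refl = contradiction refl (All.lookup x∉ y∈)
  ... | there y∈′ = y∈′

unique-⊆-length : {xs ys : List A} → Unique xs → (∀ {x} → x ∈ xs → x ∈ ys) → length xs ≤ length ys
unique-⊆-length [] _ = z≤n
unique-⊆-length u@(_ ∷ u′) sub with unique-⊆-uncons u sub
... | _ , ys↭ , sub′ = subst (_ ≤_) (sym (↭-length ys↭)) (s≤s (unique-⊆-length u′ sub′))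

-- Pigeonhole: the length bound leaves `ys` no room for repetitions or further elements. Three
-- bijections rest on it: multiplication on nonzero residues, powers of g onto units, and points
-- onto strata.
unique-⊆-↭ : {xs ys : List A} → Unique xs → (∀ {x} → x ∈ xs → x ∈ ys) → length ys ≤ length xs → xs ↭ ys
unique-⊆-↭ {ys = []}    []         _   _   = ↭-refl
unique-⊆-↭ {ys = _ ∷ _} []         _   ()
unique-⊆-↭ {xs = x ∷ _} u@(_ ∷ u′) sub len with unique-⊆-uncons u sub
... | _ , ys↭ , sub′ = ↭-trans
  (prep x (unique-⊆-↭ u′ sub′ (s≤s⁻¹ (subst (_≤ _) (↭-length ys↭) len)))) (↭-sym ys↭)

-- Multiplicative orders modulo n

^-distribʳ-* : ∀ k a b → (a * b) ^ k ≡ a ^ k * b ^ k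
^-distribʳ-* zero    a b = refl
^-distribʳ-* (suc k) a b = trans (cong (a * b *_) (^-distribʳ-* k a b))
  ([m*n]*[o*p]≡[m*o]*[n*p] a b (a ^ k) (b ^ k))

^-monoʳ-∣ : ∀ a {i j} → i ≤ j → a ^ i ∣ a ^ j
^-monoʳ-∣ a {i} {j} i≤j = subst (a ^ i ∣_)
  (trans (sym (^-distribˡ-+-* a i (j ∸ i))) (cong (a ^_) (m+[n∸m]≡n i≤j))) (m∣m*n (a ^ (j ∸ i)))

coprime-*ʳ : ∀ {a b c} → Coprime a b → Coprime a c → Coprime a (b * c)
coprime-*ʳ a⊥b a⊥c (d∣a , d∣bc) =
  a⊥c (d∣a , coprime-divisor (λ (e∣d , e∣b) → a⊥b (∣-trans e∣d d∣a , e∣b)) d∣bc)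

coprime-^ʳ : ∀ {a b} k → Coprime a b → Coprime a (b ^ k)
coprime-^ʳ zero    _   = ∣1⇒≡1 ∘ proj₂
coprime-^ʳ (suc k) a⊥b = coprime-*ʳ a⊥b (coprime-^ʳ k a⊥b)

coprime-∣∣⇒*∣ : ∀ {a b c} → Coprime a b → a ∣ c → b ∣ c → a * b ∣ c
coprime-∣∣⇒*∣ {a} {b} a⊥b (divides-refl q) b∣ =
  subst (_∣ q * a) (*-comm b a) (*-monoˡ-∣ a (coprime-divisor (Coprimality.sym a⊥b) (subst (b ∣_) (*-comm q a) b∣)))

prime∤⇒coprime : ∀ {p a} → Prime p → p ∤ a → Coprime a p
prime∤⇒coprime pr p∤a (d∣a , d∣p) with prime⇒irreducible pr d∣p
... | inj₁ d≡1 = d≡1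
... | inj₂ refl = contradiction d∣a p∤a

-- The cofactor `e` decides. If `q` divides it, one factor `q` cancels; otherwise it is coprime to
-- the power of `q` that it divides, hence 1.
∣prime^ : ∀ {q d} → Prime q → ∀ j → d ∣ q ^ suc j → d ≡ q ^ suc j ⊎ d ∣ q ^ j
∣prime^ {q} {d} pr j (divides e eq) with q ∣? e
... | yes (divides e′ refl) = inj₂ (divides e′ (*-cancelˡ-≡ (q ^ j) (e′ * d) q (begin
  q * q ^ j    ≡⟨ eq ⟩
  e′ * q * d   ≡⟨ cong (_* d) (*-comm e′ q) ⟩
  q * e′ * d   ≡⟨ *-assoc q e′ d ⟩
  q * (e′ * d) ∎)))
  where
  open ≡-Reasoning
  instance _ = prime⇒nonZero pr
... | no q∤e = inj₁ (sym (trans eq (trans (cong (_* d) e≡1) (*-identityˡ d))))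
  where
  e≡1 : e ≡ 1
  e≡1 = coprime-^ʳ (suc j) (prime∤⇒coprime pr q∤e) (∣-refl , divides d (trans eq (*-comm e d)))

module _ {n : ℕ} .{{_ : NonZero n}} where

  %-cong-* : ∀ {a b c d} → a % n ≡ b % n → c % n ≡ d % n → (a * c) % n ≡ (b * d) % n
  %-cong-* {a} {b} {c} {d} p q = begin
    (a * c) % n              ≡⟨ %-distribˡ-* a c n ⟩
    ((a % n) * (c % n)) % n  ≡⟨ cong₂ (λ x y → (x * y) % n) p q ⟩
    ((b % n) * (d % n)) % n  ≡⟨ %-distribˡ-* b d n ⟨
    (b * d) % n              ∎
    where open ≡-Reasoning

  %-cong-^ : ∀ {a b} k → a % n ≡ b % n → (a ^ k) % n ≡ (b ^ k) % n
  %-cong-^ zero    _ = refl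
  %-cong-^ {a} {b} (suc k) p = %-cong-* {a} {b} p (%-cong-^ {a} {b} k p)

  %-^-1 : ∀ {a} k → a % n ≡ 1 % n → (a ^ k) % n ≡ 1 % n
  %-^-1 {a} k p = trans (%-cong-^ {a} {1} k p) (cong (_% n) (^-zeroˡ k))

  %≡⇒∣ : ∀ a b → a % n ≡ b % n → n ∣ ∣ a - b ∣
  %≡⇒∣ a b eq = divides ∣ a / n - b / n ∣ (begin
    ∣ a - b ∣                                     ≡⟨ cong₂ ∣_-_∣ (m≡m%n+[m/n]*n a n) (m≡m%n+[m/n]*n b n) ⟩
    ∣ a % n + a / n * n - b % n + b / n * n ∣     ≡⟨ cong (λ z → ∣ a % n + a / n * n - z + b / n * n ∣) eq ⟨
    ∣ a % n + a / n * n - a % n + b / n * n ∣     ≡⟨ ∣m+n-m+o∣≡∣n-o∣ (a % n) (a / n * n) (b / n * n) ⟩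
    ∣ a / n * n - b / n * n ∣                     ≡⟨ *-distribʳ-∣-∣ n (a / n) (b / n) ⟨
    ∣ a / n - b / n ∣ * n                         ∎)
    where open ≡-Reasoning

  ∣⇒%≡ : ∀ a b → n ∣ ∣ a - b ∣ → a % n ≡ b % n
  ∣⇒%≡ a b n∣ with ≤-total a b
  ... | inj₁ a≤b = sym (trans (cong (_% n) (sym (m+[n∸m]≡n a≤b)))
                     (%-remove-+ʳ a (subst (n ∣_) (m≤n⇒∣m-n∣≡n∸m a≤b) n∣)))
  ... | inj₂ b≤a = trans (cong (_% n) (sym (m+[n∸m]≡n b≤a)))
                     (%-remove-+ʳ b (subst (n ∣_) (trans (∣-∣-comm a b) (m≤n⇒∣m-n∣≡n∸m b≤a)) n∣))

  %-cancelˡ : ∀ {c} a b → Coprime c n → (c * a) % n ≡ (c * b) % n → a % n ≡ b % n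
  %-cancelˡ {c} a b c⊥n eq = ∣⇒%≡ a b (coprime-divisor (Coprimality.sym c⊥n)
    (subst (n ∣_) (sym (*-distribˡ-∣-∣ c a b)) (%≡⇒∣ (c * a) (c * b) eq)))

%-reduce : ∀ {m n} .{{_ : NonZero m}} .{{_ : NonZero n}} a b → m ∣ n → a % n ≡ b % n → a % m ≡ b % m
%-reduce a b m∣n eq = ∣⇒%≡ a b (∣-trans m∣n (%≡⇒∣ a b eq))

-- Minimality is meant with respect to divisibility, so orders are compared through gcds and no
-- least positive exponent has to be found.
record HasOrder (n : ℕ) .{{_ : NonZero n}} (a d : ℕ) : Set where
  constructor hasOrder
  field
    annihilates : (a ^ d) % n ≡ 1 % n
    minimal     : ∀ k → (a ^ k) % n ≡ 1 % n → d ∣ k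

open HasOrder

module _ {n : ℕ} .{{_ : NonZero n}} where

  ∣⇒^≡1 : ∀ {a d k} → (a ^ d) % n ≡ 1 % n → d ∣ k → (a ^ k) % n ≡ 1 % n
  ∣⇒^≡1 {a} {d} a^d≡1 (divides-refl q) = begin
    (a ^ (q * d)) % n  ≡⟨ cong (λ z → (a ^ z) % n) (*-comm q d) ⟩
    (a ^ (d * q)) % n  ≡⟨ cong (_% n) (^-*-assoc a d q) ⟨
    ((a ^ d) ^ q) % n  ≡⟨ %-^-1 {n} {a ^ d} q a^d≡1 ⟩
    1 % n              ∎
    where open ≡-Reasoning

  hasOrder-* : ∀ {a b d e} → HasOrder n a d → HasOrder n b e → Coprime d e → HasOrder n (a * b) (d * e)
  hasOrder-* {a} {b} {d} {e} oa ob d⊥e .annihilates = begin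
    ((a * b) ^ (d * e)) % n          ≡⟨ cong (_% n) (^-distribʳ-* (d * e) a b) ⟩
    (a ^ (d * e) * b ^ (d * e)) % n  ≡⟨ %-cong-* {n} {a ^ (d * e)} {1} {b ^ (d * e)} {1}
                                          (∣⇒^≡1 {a} {d} (oa .annihilates) (m∣m*n e)) (∣⇒^≡1 {b} (ob .annihilates) (n∣m*n d)) ⟩
    1 % n                            ∎
    where open ≡-Reasoning
  hasOrder-* {a} {b} {d} {e} oa ob d⊥e .minimal k ab^k≡1 = coprime-∣∣⇒*∣ d⊥e
    (coprime-divisor d⊥e (subst (d ∣_) (*-comm k e) (oa .minimal (k * e) (half a b e (ob .annihilates) ab^k≡1))))
    (coprime-divisor (Coprimality.sym d⊥e) (subst (e ∣_) (*-comm k d)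
      (ob .minimal (k * d) (half b a d (oa .annihilates) (trans (cong (λ z → (z ^ k) % n) (*-comm b a)) ab^k≡1)))))
    where
    -- Raising `(a * b) ^ k` to the power `e` removes `b` and leaves a condition on `a` alone.
    half : ∀ a b e → (b ^ e) % n ≡ 1 % n → ((a * b) ^ k) % n ≡ 1 % n → (a ^ (k * e)) % n ≡ 1 % n
    half a b e b^e≡1 ab^k≡1 = begin
      (a ^ (k * e)) % n                ≡⟨ cong (_% n) (*-identityʳ (a ^ (k * e))) ⟨
      (a ^ (k * e) * 1) % n            ≡⟨ %-cong-* {n} {a ^ (k * e)} {_} {1} refl (sym (∣⇒^≡1 {b} b^e≡1 (n∣m*n k))) ⟩
      (a ^ (k * e) * b ^ (k * e)) % n  ≡⟨ cong (_% n) (^-distribʳ-* (k * e) a b) ⟨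
      ((a * b) ^ (k * e)) % n          ≡⟨ ∣⇒^≡1 {a * b} {k} ab^k≡1 (m∣m*n e) ⟩
      1 % n                            ∎
      where open ≡-Reasoning

  -- With `d` = φ(p^i) this is the origin of u(i,k). If `a ^ (k * j)` is 1, then `d` divides both
  -- `j * d` and `j * k`, hence their gcd `j * gcd d k`.
  hasOrder-^ : ∀ {a d} k → HasOrder n a d → .{{_ : NonZero (gcd d k)}} → HasOrder n (a ^ k) (d / gcd d k)
  hasOrder-^ {a} {d} k o .annihilates = trans (cong (_% n) (^-*-assoc a k (d / gcd d k)))
    (∣⇒^≡1 {a} (o .annihilates) (subst (_∣ k * (d / gcd d k)) (m*[n/m]≡n (gcd[m,n]∣m d k))
      (*-monoˡ-∣ (d / gcd d k) (gcd[m,n]∣n d k))))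
  hasOrder-^ {a} {d} k o .minimal j eq = m∣n*o⇒m/n∣o (gcd[m,n]∣m d k)
    (subst (d ∣_) (sym (c*gcd[m,n]≡gcd[cm,cn] j d k))
      (gcd-greatest (n∣m*n j) (subst (d ∣_) (*-comm k j)
        (o .minimal (k * j) (trans (cong (_% n) (sym (^-*-assoc a k j))) eq)))))

  -- Bézout's identity with its negative term moved to the left, so that no inverse of `a` is
  -- involved: multiplying by `a ^ (y * t)` changes nothing.
  ^-bézout≡1 : ∀ {a g} x y s t → (a ^ s) % n ≡ 1 % n → (a ^ t) % n ≡ 1 % n →
               g + y * t ≡ x * s → (a ^ g) % n ≡ 1 % n
  ^-bézout≡1 {a} {g} x y s t s≡1 t≡1 eq = begin
    (a ^ g) % n                  ≡⟨ cong (_% n) (*-identityʳ (a ^ g)) ⟨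
    (a ^ g * 1) % n              ≡⟨ %-cong-* {n} {a ^ g} {_} {1} refl (sym (∣⇒^≡1 {a} t≡1 (n∣m*n y))) ⟩
    (a ^ g * a ^ (y * t)) % n    ≡⟨ cong (_% n) (^-distribˡ-+-* a g (y * t)) ⟨
    (a ^ (g + y * t)) % n        ≡⟨ cong (λ z → (a ^ z) % n) eq ⟩
    (a ^ (x * s)) % n            ≡⟨ ∣⇒^≡1 {a} s≡1 (n∣m*n x) ⟩
    1 % n                        ∎
    where open ≡-Reasoning

  ^-gcd≡1 : ∀ {a} s t → (a ^ s) % n ≡ 1 % n → (a ^ t) % n ≡ 1 % n → (a ^ gcd s t) % n ≡ 1 % n
  ^-gcd≡1 {a} s t s≡1 t≡1 with Bézout.identity (gcd-GCD s t)
  ... | Bézout.+- x y eq = ^-bézout≡1 {a} x y s t s≡1 t≡1 eq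
  ... | Bézout.-+ x y eq = ^-bézout≡1 {a} y x t s t≡1 s≡1 eq

  -- For a prime power it is enough to test the exponent `q ^ j`: if `k` annihilates `a`, so does
  -- its gcd with `q ^ suc j`, which is either the full power or a divisor of `q ^ j`.
  hasOrder-prime^ : ∀ {a q} → Prime q → ∀ j → (a ^ (q ^ suc j)) % n ≡ 1 % n →
                    (a ^ (q ^ j)) % n ≢ 1 % n → HasOrder n a (q ^ suc j)
  hasOrder-prime^ {a} {q} pr j ≡1 ≢1 .annihilates = ≡1
  hasOrder-prime^ {a} {q} pr j ≡1 ≢1 .minimal k k≡1
    with ∣prime^ pr j (gcd[m,n]∣m (q ^ suc j) k)
  ... | inj₁ g≡ = subst (_∣ k) g≡ (gcd[m,n]∣n (q ^ suc j) k)
  ... | inj₂ g∣ = contradiction (∣⇒^≡1 {a} (^-gcd≡1 {a} (q ^ suc j) k ≡1 k≡1) g∣) ≢1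

-- Primitive roots modulo p

-- Monic polynomial functions, defined through division by x - r so that
-- no coefficients are needed.
IsMonic : ℕ → (ℤ → ℤ) → Set
IsMonic zero    f = ∀ x → f x ≡ 1ℤ
IsMonic (suc d) f = ∀ r → ∃ λ q → IsMonic d q × (∀ x → f x ℤ.- f r ≡ (x ℤ.- r) ℤ.* q x)

-- The quotients by `x - r` add up in the same way, so the sum of them has this very shape one
-- degree lower. It serves the quotient found in `isMonic-x*`.
isMonic-+* : ∀ d {f q} → IsMonic (suc d) f → IsMonic d q → ∀ c → IsMonic (suc d) (λ x → f x ℤ.+ c ℤ.* q x)
isMonic-+* zero {f} {q} fm qm c r with fm r
... | f′ , f′m , eq = f′ , f′m , λ x → trans
  (cong₂ (λ y z → (f x ℤ.+ c ℤ.* y) ℤ.- (f r ℤ.+ c ℤ.* z)) (qm x) (qm r))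
  (trans (cancel (f x) (f r) c) (eq x))
  where
  cancel : ∀ a b c → (a ℤ.+ c ℤ.* 1ℤ) ℤ.- (b ℤ.+ c ℤ.* 1ℤ) ≡ a ℤ.- b
  cancel = ℤ-solve-∀
isMonic-+* (suc d) {f} {q} fm qm c r with fm r | qm r
... | f′ , f′m , feq | q′ , q′m , qeq = _ , isMonic-+* d {f′} {q′} f′m q′m c , λ x → begin
  (f x ℤ.+ c ℤ.* q x) ℤ.- (f r ℤ.+ c ℤ.* q r)                ≡⟨ split (f x) (f r) (q x) (q r) c ⟩
  (f x ℤ.- f r) ℤ.+ c ℤ.* (q x ℤ.- q r)                      ≡⟨ cong₂ (λ y z → y ℤ.+ c ℤ.* z) (feq x) (qeq x) ⟩
  (x ℤ.- r) ℤ.* f′ x ℤ.+ c ℤ.* ((x ℤ.- r) ℤ.* q′ x)          ≡⟨ factor (x ℤ.- r) (f′ x) (q′ x) c ⟩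
  (x ℤ.- r) ℤ.* (f′ x ℤ.+ c ℤ.* q′ x)                        ∎
  where
  open ≡-Reasoning
  split : ∀ a b y z c → (a ℤ.+ c ℤ.* y) ℤ.- (b ℤ.+ c ℤ.* z) ≡ (a ℤ.- b) ℤ.+ c ℤ.* (y ℤ.- z)
  split = ℤ-solve-∀
  factor : ∀ s a b c → s ℤ.* a ℤ.+ c ℤ.* (s ℤ.* b) ≡ s ℤ.* (a ℤ.+ c ℤ.* b)
  factor = ℤ-solve-∀

-- A Horner step. Splitting x f(x) - r f(r) into (x - r) f(x) + r (f(x) - f(r)) shows that the
-- quotient is f + r q, where q is the quotient of f.
isMonic-x* : ∀ d {f} → IsMonic d f → ∀ c → IsMonic (suc d) (λ x → c ℤ.+ x ℤ.* f x)
isMonic-x* zero {f} fm c r = (λ _ → 1ℤ) , (λ _ → refl) , λ x → trans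
  (cong₂ (λ y z → (c ℤ.+ x ℤ.* y) ℤ.- (c ℤ.+ r ℤ.* z)) (fm x) (fm r)) (cancel c x r)
  where
  cancel : ∀ c x r → (c ℤ.+ x ℤ.* 1ℤ) ℤ.- (c ℤ.+ r ℤ.* 1ℤ) ≡ (x ℤ.- r) ℤ.* 1ℤ
  cancel = ℤ-solve-∀
isMonic-x* (suc d) {f} fm c r with fm r
... | q , qm , eq = _ , isMonic-+* d {f} {q} fm qm r , λ x → begin
  (c ℤ.+ x ℤ.* f x) ℤ.- (c ℤ.+ r ℤ.* f r)                 ≡⟨ split c x r (f x) (f r) ⟩
  (x ℤ.- r) ℤ.* f x ℤ.+ r ℤ.* (f x ℤ.- f r)               ≡⟨ cong (λ z → (x ℤ.- r) ℤ.* f x ℤ.+ r ℤ.* z) (eq x) ⟩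
  (x ℤ.- r) ℤ.* f x ℤ.+ r ℤ.* ((x ℤ.- r) ℤ.* q x)         ≡⟨ factor (x ℤ.- r) (f x) (q x) r ⟩
  (x ℤ.- r) ℤ.* (f x ℤ.+ r ℤ.* q x)                       ∎
  where
  open ≡-Reasoning
  split : ∀ c x r a b → (c ℤ.+ x ℤ.* a) ℤ.- (c ℤ.+ r ℤ.* b) ≡ (x ℤ.- r) ℤ.* a ℤ.+ r ℤ.* (a ℤ.- b)
  split = ℤ-solve-∀
  factor : ∀ s a b c → s ℤ.* a ℤ.+ c ℤ.* (s ℤ.* b) ≡ s ℤ.* (a ℤ.+ c ℤ.* b)
  factor = ℤ-solve-∀

∣pos-pos∣ : ∀ m n → ℤ.∣ pos m ℤ.- pos n ∣ ≡ ∣ m - n ∣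
∣pos-pos∣ m n = trans (cong ℤ.∣_∣ (ℤ.m-n≡m⊖n m n)) (go m n)
  where
  go : ∀ m n → ℤ.∣ m ℤ.⊖ n ∣ ≡ ∣ m - n ∣
  go zero    zero    = refl
  go zero    (suc n) = refl
  go (suc m) zero    = refl
  go (suc m) (suc n) = trans (cong ℤ.∣_∣ (ℤ.[1+m]⊖[1+n]≡m⊖n m n)) (go m n)

module _ {p : ℕ} (p-prime : Prime p) where

  -- Lagrange's bound: after division by x minus the first root, Euclid's lemma makes every other
  -- root a root of the quotient, because `p` does not divide the difference of the two roots.
  monic-roots : ∀ d {f} → IsMonic d f → {xs : List ℕ} → AllPairs (λ x y → p ∤ ∣ y - x ∣) xs →
                All (λ x → pos p ℤ∣.∣ f (pos x)) xs → length xs ≤ d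
  monic-roots d       fm [] [] = z≤n
  monic-roots zero    {f} fm {x ∷ _} (_ ∷ _) (root ∷ _) =
    contradiction (subst Prime (∣1⇒≡1 (subst (λ z → p ∣ ℤ.∣ z ∣) (fm (pos x)) (∣⇒∣ᵤ root))) p-prime) ¬prime[1]
  monic-roots (suc d) {f} fm {x ∷ xs} (apart ∷ aparts) (root ∷ roots) with fm (pos x)
  ... | q , qm , eq = s≤s (monic-roots d qm aparts (All.zipWith quotientRoot (apart , roots)))
    where
    quotientRoot : ∀ {y} → (p ∤ ∣ y - x ∣) × (pos p ℤ∣.∣ f (pos y)) → pos p ℤ∣.∣ q (pos y)
    quotientRoot {y} (p∤ , rooty) with euclidsLemma ∣ y - x ∣ ℤ.∣ q (pos y) ∣ p-prime
      (subst (p ∣_) (trans (ℤ.abs-* (pos y ℤ.- pos x) (q (pos y))) (cong (_* ℤ.∣ q (pos y) ∣) (∣pos-pos∣ y x)))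
        (∣⇒∣ᵤ {pos p} (subst (pos p ℤ∣.∣_) (eq (pos y)) (ℤ∣.∣m∣n⇒∣m-n rooty root))))
    ... | inj₁ p∣ = contradiction p∣ p∤
    ... | inj₂ p∣ = ∣ᵤ⇒∣ p∣

isMonic-^ : ∀ d → IsMonic d (λ x → x ℤ.^ d)
isMonic-^ zero    = λ _ → refl
isMonic-^ (suc d) r with isMonic-x* d {λ x → x ℤ.^ d} (isMonic-^ d) ℤ.0ℤ r
... | q , qm , eq = q , qm , λ x → trans (sym (cong₂ ℤ._-_ (ℤ.+-identityˡ (x ℤ.* x ℤ.^ d)) (ℤ.+-identityˡ (r ℤ.* r ℤ.^ d)))) (eq x)

pos-^ : ∀ x d → (pos x) ℤ.^ d ≡ pos (x ^ d)
pos-^ x zero    = refl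
pos-^ x (suc d) = trans (cong (pos x ℤ.*_) (pos-^ x d)) (sym (ℤ.pos-* x (x ^ d)))

module _ {n : ℕ} (p-prime : Prime (suc n)) where

  private
    p = suc n
    nonzeroResidues = applyUpTo suc n

    1<p : 1 < p
    1<p = nonTrivial⇒n>1 p {{prime⇒nonTrivial p-prime}}

  residue∤ : ∀ {x} → x ∈ nonzeroResidues → p ∤ x
  residue∤ x∈ with ∈-applyUpTo⁻ suc x∈
  ... | _ , i<n , refl = >⇒∤ (s≤s i<n)

  -- Otherwise x^e - 1, monic of degree `e`, would have all `n` = p - 1 nonzero residues as roots,
  -- against Lagrange's bound.
  exists-nonroot : ∀ {e} .{{_ : NonZero e}} → e < n →
                   ∃ λ x → x ∈ nonzeroResidues × (x ^ e) % p ≢ 1 % p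
  exists-nonroot {suc e} e<n with all? (λ x → (x ^ suc e) % p ≟ 1 % p) nonzeroResidues
  ... | no ¬all = let (x , x∈ , ≢1) = find (¬All⇒Any¬ (λ x → (x ^ suc e) % p ≟ 1 % p) _ ¬all) in x , x∈ , ≢1
  ... | yes all = contradiction e<n (≤⇒≯ (subst (_≤ suc e) (length-applyUpTo suc n)
      (monic-roots p-prime (suc e) {λ x → ℤ.-1ℤ ℤ.+ x ℤ.* x ℤ.^ e} (isMonic-x* e {λ x → x ℤ.^ e} (isMonic-^ e) ℤ.-1ℤ) apart (All.map (λ {x} → root {x}) all))))
    where
    apart : AllPairs (λ x y → p ∤ ∣ y - x ∣) nonzeroResidues
    apart = AllPairs.applyUpTo⁺₁ suc n λ {i} {j} i<j j<n → subst (p ∤_)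
      (sym (trans (∣-∣-comm j i) (m≤n⇒∣m-n∣≡n∸m (<⇒≤ i<j))))
      (>⇒∤ {{>-nonZero (m<n⇒0<n∸m i<j)}} (s≤s (≤-trans (m∸n≤m j i) (<⇒≤ j<n))))
    root : ∀ {x} → (x ^ suc e) % p ≡ 1 % p → pos p ℤ∣.∣ (ℤ.-1ℤ ℤ.+ (pos x) ℤ.* (pos x) ℤ.^ e)
    root {x} eq = ∣ᵤ⇒∣ (subst (p ∣_) (sym (begin
      ℤ.∣ ℤ.-1ℤ ℤ.+ (pos x) ℤ.^ suc e ∣  ≡⟨ cong ℤ.∣_∣ (ℤ.+-comm ℤ.-1ℤ ((pos x) ℤ.^ suc e)) ⟩
      ℤ.∣ (pos x) ℤ.^ suc e ℤ.- 1ℤ ∣     ≡⟨ cong (λ z → ℤ.∣ z ℤ.- 1ℤ ∣) (pos-^ x (suc e)) ⟩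
      ℤ.∣ pos (x ^ suc e) ℤ.- pos 1 ∣      ≡⟨ ∣pos-pos∣ (x ^ suc e) 1 ⟩
      ∣ x ^ suc e - 1 ∣                ∎)) (%≡⇒∣ (x ^ suc e) 1 eq))
      where open ≡-Reasoning

  product-map-*% : ∀ a xs → product (map (λ x → (a * x) % p) xs) % p ≡ (a ^ length xs * product xs) % p
  product-map-*% a []       = refl
  product-map-*% a (x ∷ xs) = begin
    ((a * x) % p * product (map (λ x → (a * x) % p) xs)) % p
      ≡⟨ %-cong-* {p} {(a * x) % p} {a * x} (m%n%n≡m%n (a * x) p) (product-map-*% a xs) ⟩
    (a * x * (a ^ length xs * product xs)) % p
      ≡⟨ cong (_% p) ([m*n]*[o*p]≡[m*o]*[n*p] a x (a ^ length xs) (product xs)) ⟩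
    (a ^ suc (length xs) * product (x ∷ xs)) % p ∎
    where open ≡-Reasoning

  product∤ : ∀ {xs} → All (p ∤_) xs → p ∤ product xs
  product∤ []         p∣1 = contradiction (∣1⇒≡1 p∣1) (>⇒≢ 1<p)
  product∤ {x ∷ xs} (p∤x ∷ ps) p∣ with euclidsLemma x (product xs) p-prime p∣
  ... | inj₁ p∣x = p∤x p∣x
  ... | inj₂ p∣P = product∤ ps p∣P

  -- Multiplication by `a` permutes the nonzero residues. Comparing their product before and after,
  -- and cancelling that product, leaves `a ^ n`.
  fermat : ∀ {a} → p ∤ a → (a ^ n) % p ≡ 1 % p
  fermat {a} p∤a = %-cancelˡ (a ^ n) 1 (prime∤⇒coprime p-prime (product∤ (All.tabulate residue∤))) (begin
    (P * a ^ n) % p                                           ≡⟨ cong (_% p) (*-comm P (a ^ n)) ⟩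
    (a ^ n * P) % p                                           ≡⟨ cong (λ z → (a ^ z * P) % p) (length-applyUpTo suc n) ⟨
    (a ^ length nonzeroResidues * P) % p                      ≡⟨ product-map-*% a nonzeroResidues ⟨
    product (map times nonzeroResidues) % p                   ≡⟨ cong (_% p) (product-↭ times-↭) ⟩
    P % p                                                     ≡⟨ cong (_% p) (*-identityʳ P) ⟨
    (P * 1) % p                                               ∎)
    where
    open ≡-Reasoning
    P = product nonzeroResidues
    times = λ x → (a * x) % p
    a⊥p = prime∤⇒coprime p-prime p∤a
    unique = subst (AllPairs _≢_) (sym (map-applyUpTo suc times n))
      (Unique.applyUpTo⁺₁ (times ∘ suc) n λ {i} {j} i<j j<n eq → <⇒≢ (s≤s i<j) (begin
        suc i      ≡⟨ m<n⇒m%n≡m (s≤s (<-trans i<j j<n)) ⟨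
        suc i % p  ≡⟨ %-cancelˡ (suc i) (suc j) a⊥p eq ⟩
        suc j % p  ≡⟨ m<n⇒m%n≡m (s≤s j<n) ⟩
        suc j      ∎))
    times∈ : ∀ {y} → y ∈ map times nonzeroResidues → y ∈ nonzeroResidues
    times∈ y∈ with ∈-map⁻ times y∈
    ... | x , x∈ , refl with (a * x) % p in eq | m%n<n (a * x) p
    ...   | zero  | _ = contradiction (coprime-divisor (Coprimality.sym a⊥p) (m%n≡0⇒n∣m (a * x) p eq)) (residue∤ x∈)
    ...   | suc i | s≤s i<n = ∈-applyUpTo⁺ suc i<n
    times-↭ = unique-⊆-↭ unique times∈ (≤-reflexive (sym (length-map times nonzeroResidues)))

-- Elements whose order is a given divisor of p - 1

prime-divisor : ∀ n → 1 < n → ∃ λ q → Prime q × q ∣ n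
prime-divisor n 1<n with factorise n {{>-nonZero (<-trans z<s 1<n)}}
... | record { factors = [] ; isFactorisation = eq } = contradiction eq (>⇒≢ 1<n)
... | record { factors = q ∷ qs ; isFactorisation = eq ; factorsPrime = pr ∷ _ } =
  q , pr , subst (q ∣_) (sym eq) (m∣m*n (product qs))

extract-prime : ∀ {q} → Prime q → ∀ d .{{_ : NonZero d}} → ∃ λ j → ∃ λ e → d ≡ q ^ j * e × q ∤ e
extract-prime {q} pr = <-rec _ go
  where
  instance _ = prime⇒nonTrivial pr
  go : ∀ d → (∀ {d′} → d′ < d → .{{_ : NonZero d′}} → ∃ λ j → ∃ λ e → d′ ≡ q ^ j * e × q ∤ e) →
       .{{_ : NonZero d}} → ∃ λ j → ∃ λ e → d ≡ q ^ j * e × q ∤ e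
  go d rec with q ∣? d
  ... | no q∤d = 0 , d , sym (*-identityˡ d) , q∤d
  ... | yes q∣d with rec (quotient-< q∣d) {{quotient≢0 q∣d}}
  ...   | j , e , eq , q∤e = suc j , e , trans (m∣n⇒n≡m*quotient q∣d) (trans (cong (q *_) eq) (sym (*-assoc q (q ^ j) e))) , q∤e

module _ {n : ℕ} (p-prime : Prime (suc n)) where

  private
    p = suc n
    instance
      n≢0 : NonZero n
      n≢0 = >-nonZero (s≤s⁻¹ (nonTrivial⇒n>1 p {{prime⇒nonTrivial p-prime}}))

  -- Write n = c q^(j+1) and take x with x^(n/q) different from 1. Then a = x^c works: its power
  -- q^(j+1) is x^n, which is 1 by Fermat, and its power q^j is x^(n/q).
  exists-order-prime^ : ∀ {q} → Prime q → ∀ j → q ^ suc j ∣ n → ∃ λ a → HasOrder p a (q ^ suc j)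
  exists-order-prime^ {q} pr j (divides c eq)
    with exists-nonroot p-prime {q ^ j * c} {{≢-nonZero e≢0}} e<n
    where
    n≡ : n ≡ q * (q ^ j * c)
    n≡ = trans eq (trans (*-comm c (q ^ suc j)) (*-assoc q (q ^ j) c))
    e≢0 : q ^ j * c ≢ 0
    e≢0 e≡0 = ≢-nonZero⁻¹ n (trans n≡ (trans (cong (q *_) e≡0) (*-zeroʳ q)))
    e<n : q ^ j * c < n
    e<n = subst (q ^ j * c <_) (sym (trans n≡ (*-comm q (q ^ j * c)))) (m<m*n (q ^ j * c) q {{≢-nonZero e≢0}} (nonTrivial⇒n>1 q {{prime⇒nonTrivial pr}}))
  ... | x , x∈ , ≢1 = x ^ c , hasOrder-prime^ pr j
      (trans (cong (_% p) (trans (^-*-assoc x c (q ^ suc j)) (cong (x ^_) (sym eq)))) (fermat p-prime (residue∤ p-prime x∈)))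
      (λ ≡1 → ≢1 (trans (cong (_% p) (trans (cong (x ^_) (*-comm (q ^ j) c)) (sym (^-*-assoc x c (q ^ j))))) ≡1))

  -- Splits off the full power of one prime `q` from `d`; the cofactor `e` is smaller and coprime to
  -- it, so the two elements multiply to one of order `d`.
  exists-order-step : ∀ {d} → 1 < d → d ∣ n → (∀ {e} → e < d → e ∣ n → ∃ λ a → HasOrder p a e) → ∃ λ a → HasOrder p a d
  exists-order-step {d} 1<d d∣n rec with prime-divisor d 1<d
  ... | q , pr , q∣d with extract-prime pr d {{>-nonZero (<-trans z<s 1<d)}}
  ...   | zero , e , eq , q∤e = contradiction (subst (q ∣_) (trans eq (*-identityˡ e)) q∣d) q∤e
  ...   | suc j , e , eq , q∤e =
    let (a , oa) = exists-order-prime^ pr j (∣-trans (subst (q ^ suc j ∣_) (sym eq) (m∣m*n e)) d∣n)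
        (b , ob) = rec e<d (∣-trans e∣d d∣n)
    in a * b , subst (HasOrder p (a * b)) (sym eq)
         (hasOrder-* oa ob (Coprimality.sym (coprime-^ʳ (suc j) (prime∤⇒coprime pr q∤e))))
    where
    e∣d : e ∣ d
    e∣d = divides (q ^ suc j) eq
    e<d : e < d
    e<d = ≤∧≢⇒< (∣⇒≤ {{>-nonZero (<-trans z<s 1<d)}} e∣d) λ e≡d → q∤e (subst (q ∣_) (sym e≡d) q∣d)

  exists-order : ∀ d → d ∣ n → ∃ λ a → HasOrder p a d
  exists-order = <-rec _ go
    where
    go : ∀ d → (∀ {e} → e < d → e ∣ n → ∃ λ a → HasOrder p a e) → d ∣ n → ∃ λ a → HasOrder p a d
    go 0       rec 0∣n = contradiction (0∣⇒≡0 0∣n) (≢-nonZero⁻¹ n)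
    go 1       rec _   = 1 , hasOrder refl (λ k _ → 1∣ k)
    go (2+ d)  rec d∣n = exists-order-step (s≤s z<s) d∣n rec

primitive-root-prime : ∀ {p} (p-prime : Prime p) → ∃ λ h → HasOrder p {{prime⇒nonZero p-prime}} h (pred p)
primitive-root-prime {zero}  p-prime = contradiction p-prime ¬prime[0]
primitive-root-prime {suc n} p-prime = exists-order p-prime n ∣-refl

-- Primitive roots modulo powers of p

-- The binomial coefficient n(n-1)/2, by recursion so that no division occurs.
triangle : ℕ → ℕ
triangle zero    = 0
triangle (suc n) = triangle n + n

2*triangle : ∀ n → 2 * triangle n + n ≡ n * n
2*triangle zero    = refl
2*triangle (suc n) = trans (regroup (triangle n) n) (trans (cong (_+ (n + suc n)) (2*triangle n)) (square n))
  where
  regroup : ∀ t n → 2 * (t + n) + suc n ≡ 2 * t + n + (n + suc n)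
  regroup = ℕ-solve-∀
  square : ∀ n → n * n + (n + suc n) ≡ suc n * suc n
  square = ℕ-solve-∀

[1+y]^-expansion : ∀ n y → ∃ λ r → (1 + y) ^ n ≡ 1 + n * y + triangle n * (y * y) + r * (y * y * y)
[1+y]^-expansion zero    y = 0 , refl
[1+y]^-expansion (suc n) y with [1+y]^-expansion n y
... | r , eq = r + triangle n + r * y , trans (cong ((1 + y) *_) eq) (expand n y (triangle n) r)
  where
  expand : ∀ n y t r → (1 + y) * (1 + n * y + t * (y * y) + r * (y * y * y))
                     ≡ 1 + suc n * y + (t + n) * (y * y) + (r + t + r * y) * (y * y * y)
  expand = ℕ-solve-∀

%≡1⇒ : ∀ {n a} → 1 < n → .{{_ : NonZero n}} → a % n ≡ 1 % n → a ≡ 1 + n * (a / n)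
%≡1⇒ {n} {a} 1<n eq = trans (m≡m%n+[m/n]*n a n) (cong₂ _+_ (trans eq (m<n⇒m%n≡m 1<n)) (*-comm (a / n) n))

[1+n*c]%n : ∀ n c .{{_ : NonZero n}} → (1 + n * c) % n ≡ 1 % n
[1+n*c]%n n c = trans (cong (λ z → (1 + z) % n) (*-comm n c)) ([m+kn]%n≡m%n 1 c n)

-- The binomial expansion at y = p Q c with Q = p^i, and `t * p` in place of `triangle p`. The
-- quadratic and cubic terms have one factor p more than the linear one, so `c` changes only by a
-- multiple of p.
lift-expansion : ∀ p Q c t r →
  1 + p * (p * Q * c) + t * p * (p * Q * c * (p * Q * c)) + r * (p * Q * c * (p * Q * c) * (p * Q * c))
  ≡ 1 + p * (p * Q) * (c + p * (t * Q * (c * c) + Q * Q * r * (c * c * c)))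
lift-expansion = ℕ-solve-∀

module _ {p : ℕ} (p-prime : Prime p) (p-odd : 2 ∤ p) where

  private
    1<p : 1 < p
    1<p = nonTrivial⇒n>1 p {{prime⇒nonTrivial p-prime}}

    instance
      p≢0 : NonZero p
      p≢0 = prime⇒nonZero p-prime

  -- `2*triangle` makes p divide 2 times the triangle number, and oddness cancels the 2. For p = 2
  -- it fails, since `triangle 2` is 1.
  prime∣triangle : p ∣ triangle p
  prime∣triangle = coprime-divisor (prime∤⇒coprime prime[2] p-odd)
    (∣m+n∣m⇒∣n (subst (p ∣_) (trans (sym (2*triangle p)) (+-comm (2 * triangle p) p)) (m∣m*n p)) ∣-refl)

  -- Since p is odd, it divides the coefficient of the quadratic term too.
  [1+p^j*c]^p : ∀ i c → ∃ λ c′ → (1 + p ^ suc i * c) ^ p ≡ 1 + p ^ (2 + i) * c′ × (p ∤ c → p ∤ c′)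
  [1+p^j*c]^p i c = lift prime∣triangle ([1+y]^-expansion p (p ^ suc i * c))
    where
    y = p ^ suc i * c
    lift : p ∣ triangle p → (∃ λ r → (1 + y) ^ p ≡ 1 + p * y + triangle p * (y * y) + r * (y * y * y)) →
           ∃ λ c′ → (1 + y) ^ p ≡ 1 + p ^ (2 + i) * c′ × (p ∤ c → p ∤ c′)
    lift (divides t teq) (r , eq) =
      c + p * e ,
      trans eq (trans (cong (λ z → 1 + p * y + z * (y * y) + r * (y * y * y)) teq) (lift-expansion p (p ^ i) c t r)) ,
      λ p∤c p∣c′ → p∤c (∣m+n∣m⇒∣n (subst (p ∣_) (+-comm c (p * e)) p∣c′) (m∣m*n e))
      where
      e = t * p ^ i * (c * c) + p ^ i * p ^ i * r * (c * c * c)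

  -- The equation, for arbitrary `c`, trivialises powers of `h`; the clause that `p` still does not
  -- divide `c′` bounds the order of 1 + p from below.
  [1+p*c]^p^j : ∀ c j → ∃ λ c′ → (1 + p * c) ^ (p ^ j) ≡ 1 + p ^ suc j * c′ × (p ∤ c → p ∤ c′)
  [1+p*c]^p^j c zero = c , trans (^-identityʳ (1 + p * c)) (cong (λ z → 1 + z * c) (sym (^-identityʳ p))) , λ p∤c → p∤c
  [1+p*c]^p^j c (suc j) = c₂ , (begin
    (1 + p * c) ^ (p * p ^ j)    ≡⟨ cong ((1 + p * c) ^_) (*-comm p (p ^ j)) ⟩
    (1 + p * c) ^ (p ^ j * p)    ≡⟨ ^-*-assoc (1 + p * c) (p ^ j) p ⟨
    ((1 + p * c) ^ (p ^ j)) ^ p  ≡⟨ cong (_^ p) (proj₁ (proj₂ ih)) ⟩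
    (1 + p ^ suc j * c₁) ^ p     ≡⟨ proj₁ (proj₂ step) ⟩
    1 + p ^ (2 + j) * c₂         ∎) , proj₂ (proj₂ step) ∘ proj₂ (proj₂ ih)
    where
    open ≡-Reasoning
    ih   = [1+p*c]^p^j c j
    c₁   = proj₁ ih
    step = [1+p^j*c]^p j c₁
    c₂   = proj₁ step

  -- The p^j-th power of 1 + p is 1 + p^(j+1) c with c prime to p. It is therefore 1 modulo p^(j+1)
  -- but not modulo p^(j+2), which is all that a prime power order requires.
  hasOrder-1+p : ∀ i .{{_ : NonZero (p ^ suc i)}} → HasOrder (p ^ suc i) (1 + p * 1) (p ^ i)
  hasOrder-1+p = order
    where
    c : ℕ → ℕ
    c j = proj₁ ([1+p*c]^p^j 1 j)
    power : ∀ j → (1 + p * 1) ^ (p ^ j) ≡ 1 + p ^ suc j * c j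
    power j = proj₁ (proj₂ ([1+p*c]^p^j 1 j))
    p∤c : ∀ j → p ∤ c j
    p∤c j = proj₂ (proj₂ ([1+p*c]^p^j 1 j)) λ p∣1 → >⇒≢ 1<p (∣1⇒≡1 p∣1)
    annih : ∀ i .{{_ : NonZero (p ^ suc i)}} → ((1 + p * 1) ^ (p ^ i)) % (p ^ suc i) ≡ 1 % (p ^ suc i)
    annih i = trans (cong (_% (p ^ suc i)) (power i)) ([1+n*c]%n (p ^ suc i) (c i))
    order : ∀ i .{{_ : NonZero (p ^ suc i)}} → HasOrder (p ^ suc i) (1 + p * 1) (p ^ i)
    order zero    = hasOrder (annih zero) λ k _ → 1∣ k
    order (suc j) = hasOrder-prime^ p-prime j (annih (suc j)) notYet
      where
      notYet : ((1 + p * 1) ^ (p ^ j)) % (p ^ (2 + j)) ≢ 1 % (p ^ (2 + j))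
      notYet ≡1 = p∤c j
        (*-cancelˡ-∣ (p ^ suc j) {{m^n≢0 p (suc j)}} (subst (_∣ p ^ suc j * c j) (*-comm p (p ^ suc j))
          (subst (p ^ (2 + j) ∣_) (trans (cong (λ z → ∣ z - 1 ∣) (power j)) (∣-∣-identityʳ (p ^ suc j * c j)))
            (%≡⇒∣ ((1 + p * 1) ^ (p ^ j)) 1 ≡1))))

  -- The power `p ^ m` lifts h^d ≡ 1 from modulus p to modulus p^(m+1). Conversely, reduction modulo
  -- p gives back the order of h, and `d` is coprime to the additional exponent `p ^ m`.
  hasOrder-teichmüller : ∀ {h d m i} .{{_ : NonZero (p ^ suc i)}} → Coprime d p → HasOrder p h d → i ≤ m → HasOrder (p ^ suc i) (h ^ (p ^ m)) d
  hasOrder-teichmüller {h} {d} {m} {i} _ oh i≤m .annihilates = %-reduce ((h ^ (p ^ m)) ^ d) 1 (^-monoʳ-∣ p (s≤s i≤m)) (begin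
    ((h ^ (p ^ m)) ^ d) % N                ≡⟨ cong (_% N) (^-*-assoc h (p ^ m) d) ⟩
    (h ^ (p ^ m * d)) % N                  ≡⟨ cong (λ z → (h ^ z) % N) (*-comm (p ^ m) d) ⟩
    (h ^ (d * p ^ m)) % N                  ≡⟨ cong (_% N) (^-*-assoc h d (p ^ m)) ⟨
    ((h ^ d) ^ (p ^ m)) % N                ≡⟨ cong (λ z → (z ^ (p ^ m)) % N) (%≡1⇒ 1<p (oh .annihilates)) ⟩
    ((1 + p * (h ^ d / p)) ^ (p ^ m)) % N  ≡⟨ cong (_% N) (proj₁ (proj₂ lifted)) ⟩
    (1 + N * proj₁ lifted) % N             ≡⟨ [1+n*c]%n N (proj₁ lifted) ⟩
    1 % N                                  ∎)
    where
    open ≡-Reasoning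
    N = p ^ suc m
    instance
      N≢0 : NonZero (p ^ suc m)
      N≢0 = m^n≢0 p (suc m)
    lifted = [1+p*c]^p^j (h ^ d / p) m
  hasOrder-teichmüller {h} {d} {m} {i} d⊥p oh i≤m .minimal k ≡1 = coprime-divisor (coprime-^ʳ m d⊥p)
    (oh .minimal (p ^ m * k) (trans (cong (_% p) (sym (^-*-assoc h (p ^ m) k)))
      (%-reduce {p} {p ^ suc i} ((h ^ (p ^ m)) ^ k) 1 (m∣m*n (p ^ i)) ≡1)))

  -- The exponent `p ^ m` is fitted to the largest modulus, so that g does not depend on `i`; p - 1
  -- and p^i are coprime, so the orders of the factors multiply.
  primitive-root : ∀ m → ∃ λ g → ∀ {i} .{{_ : NonZero (p ^ suc i)}} → i ≤ m → HasOrder (p ^ suc i) g (pred p * p ^ i)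
  primitive-root m = h ^ (p ^ m) * (1 + p * 1) , λ {i} i≤m →
    hasOrder-* (hasOrder-teichmüller p-1⊥p oh i≤m) (hasOrder-1+p i) (coprime-^ʳ i p-1⊥p)
    where
    h  = proj₁ (primitive-root-prime p-prime)
    oh = proj₂ (primitive-root-prime p-prime)
    p-1⊥p : Coprime (pred p) p
    p-1⊥p = Coprimality.sym (prime⇒coprime p-prime {{>-nonZero (s≤s⁻¹ (subst (1 <_) (sym (suc-pred p)) 1<p))}}
      (≤-reflexive (suc-pred p)))

-- Totatives and strata of ℤ/pᵐ

∈[1⋯]⁺ : ∀ {k n} → 0 < k → k ≤ n → k ∈ [1⋯ n ]
∈[1⋯]⁺ (s≤s _) k≤n = ∈-map⁺ suc (∈-upTo⁺ k≤n)

∈[1⋯]⁻ : ∀ {k n} → k ∈ [1⋯ n ] → 0 < k × k ≤ n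
∈[1⋯]⁻ k∈ with ∈-map⁻ suc k∈
... | _ , i∈ , refl = z<s , ∈-upTo⁻ i∈

[1⋯]-unique : ∀ n → Unique [1⋯ n ]
[1⋯]-unique n = Unique.map⁺ suc-injective (Unique.upTo⁺ n)

length-[1⋯] : ∀ n → length [1⋯ n ] ≡ n
length-[1⋯] n = trans (length-map suc (upTo n)) (length-upTo n)

totatives : ℕ → List ℕ
totatives n = filter (λ k → coprime? k n) [1⋯ n ]

count-multiples : ∀ p M .{{_ : NonZero p}} → count (p ∣?_) [1⋯ p * M ] ≡ M
count-multiples p M = trans (≤-antisym
  (unique-⊆-length (Unique.filter⁺ (p ∣?_) ([1⋯]-unique (p * M))) to)
  (unique-⊆-length (Unique.map⁺ (*-cancelˡ-≡ _ _ p) ([1⋯]-unique M)) from))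
  (trans (length-map (p *_) [1⋯ M ]) (length-[1⋯] M))
  where
  to : ∀ {x} → x ∈ filter (p ∣?_) [1⋯ p * M ] → x ∈ map (p *_) [1⋯ M ]
  to x∈ with ∈-filter⁻ (p ∣?_) {xs = [1⋯ p * M ]} x∈
  ... | x∈ , divides q refl with ∈[1⋯]⁻ x∈
  ...   | 0<x , x≤ = subst (_∈ map (p *_) [1⋯ M ]) (*-comm p q) (∈-map⁺ (p *_)
    (∈[1⋯]⁺ (>-nonZero⁻¹ q {{m*n≢0⇒m≢0 q {{>-nonZero 0<x}}}}) (*-cancelˡ-≤ p (subst (_≤ p * M) (*-comm q p) x≤))))
  from : ∀ {x} → x ∈ map (p *_) [1⋯ M ] → x ∈ filter (p ∣?_) [1⋯ p * M ]
  from x∈ with ∈-map⁻ (p *_) x∈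
  ... | y , y∈ , refl with ∈[1⋯]⁻ y∈
  ...   | 0<y , y≤ = ∈-filter⁺ (p ∣?_) (∈[1⋯]⁺ (*-mono-≤ (>-nonZero⁻¹ p) 0<y) (*-monoʳ-≤ p y≤)) (m∣m*n y)

module _ (n : ℕ) .{{_ : NonZero n}} where

  -- Residues run from 0 to n - 1, while `φ` counts from 1 to n. The numbers 0 and n are coprime to
  -- n under the same condition, so the shift does not affect the count.
  units≡totatives : length (units n) ≡ φ n
  units≡totatives = trans (sym (count-map (unit? n) (λ k → coprime? k n) toℕ (allFin n) (λ _ c → c) (λ _ c → c)))
    (trans (cong (count (λ k → coprime? k n)) toℕ-allFin) (+-cancelˡ-≡ (count C? (0 ∷ [])) _ _ (begin
    count C? (0 ∷ []) + count C? (upTo n)  ≡⟨ +-comm (count C? (0 ∷ [])) _ ⟩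
    count C? (upTo n) + count C? (0 ∷ [])  ≡⟨ cong (count C? (upTo n) +_) c0≡cn ⟩
    count C? (upTo n) + count C? (n ∷ [])  ≡⟨ count-++ C? (upTo n) (n ∷ []) ⟨
    count C? (upTo n ∷ʳ n)                 ≡⟨ cong (count C?) (upTo-∷ʳ n) ⟩
    count C? (upTo (suc n))                ≡⟨ cong (λ z → count C? (0 ∷ z)) (sym (map-applyUpTo (λ i → i) suc n)) ⟩
    count C? ((0 ∷ []) ++ [1⋯ n ])         ≡⟨ count-++ C? (0 ∷ []) [1⋯ n ] ⟩
    count C? (0 ∷ []) + φ n                ∎)))
    where
    open ≡-Reasoning
    C? = λ k → coprime? k n
    toℕ-allFin : map toℕ (allFin n) ≡ upTo n
    toℕ-allFin = trans (map-tabulate (λ i → i) toℕ) (go n (λ i → i))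
      where
      go : ∀ n (f : ℕ → ℕ) → List.tabulate (λ (i : Fin n) → f (toℕ i)) ≡ applyUpTo f n
      go zero    f = refl
      go (suc n) f = cong (f 0 ∷_) (go n (f ∘ suc))
    c0≡cn : count C? (0 ∷ []) ≡ count C? (n ∷ [])
    c0≡cn = sym (count-map C? C? (λ _ → n) (0 ∷ [])
      (λ { (here refl) c {d} (d∣n , _) → c (d ∣0 , d∣n) })
      (λ { (here refl) c {d} (_ , d∣n) → c (d∣n , d∣n) }))

module _ {p : ℕ} (p-prime : Prime p) where

  private
    1<p : 1 < p
    1<p = nonTrivial⇒n>1 p {{prime⇒nonTrivial p-prime}}

    instance
      p≢0 : NonZero p
      p≢0 = prime⇒nonZero p-prime

  coprime-p^⇒∤ : ∀ {i k} → Coprime k (p ^ suc i) → p ∤ k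
  coprime-p^⇒∤ {i} k⊥ p∣k = >⇒≢ 1<p (k⊥ (p∣k , m∣m*n (p ^ i)))

  ∤⇒coprime-p^ : ∀ {i k} → p ∤ k → Coprime k (p ^ suc i)
  ∤⇒coprime-p^ {i} p∤k = coprime-^ʳ (suc i) (prime∤⇒coprime p-prime p∤k)

  -- Each number is either prime to `p` or a multiple of it. Kept as a sum, this is the step of the
  -- telescoping count in `length-strata`.
  φ[p^1+i]+p^i : ∀ i → φ (p ^ suc i) + p ^ i ≡ p ^ suc i
  φ[p^1+i]+p^i i = begin
    φ N + p ^ i                                       ≡⟨ cong (φ N +_) (count-multiples p (p ^ i)) ⟨
    φ N + count (p ∣?_) [1⋯ N ]                       ≡⟨ count-⊎ (λ k → coprime? k N) (p ∣?_) (λ k → coprime? k N ⊎-dec p ∣? k)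
                                                           inj₁ inj₂ (λ z → z) (coprime-p^⇒∤ {i}) [1⋯ N ] ⟨
    count (λ k → coprime? k N ⊎-dec p ∣? k) [1⋯ N ]   ≡⟨ count-all (λ k → coprime? k N ⊎-dec p ∣? k) [1⋯ N ] (λ _ → either) ⟩
    length [1⋯ N ]                                    ≡⟨ length-[1⋯] N ⟩
    N                                                 ∎
    where
    open ≡-Reasoning
    N = p ^ suc i
    either : ∀ {k} → Coprime k N ⊎ p ∣ k
    either {k} with p ∣? k
    ... | yes p∣k = inj₂ p∣k
    ... | no  p∤k = inj₁ (∤⇒coprime-p^ {i} p∤k)

  φ[p^1+i] : ∀ i → φ (p ^ suc i) ≡ pred p * p ^ i
  φ[p^1+i] i = +-cancelʳ-≡ (p ^ i) _ _ (trans (φ[p^1+i]+p^i i)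
    (trans (cong (_* p ^ i) (sym (suc-pred p))) (+-comm (p ^ i) (pred p * p ^ i))))

  -- Factors p are peeled off one at a time. In the range from 1 to p^m the residue 0 is represented
  -- by p^m, which is peeled down to the base case and gets i = 0.
  p-adic-form : ∀ m {x} → x ∈ [1⋯ p ^ m ] → ∃ λ i → i ≤ m × ∃ λ y → y ∈ totatives (p ^ i) × x ≡ p ^ (m ∸ i) * y
  p-adic-form zero    {x} x∈ with ∈[1⋯]⁻ x∈
  ... | s≤s _ , s≤s z≤n = 0 , z≤n , 1 , ∈-filter⁺ (λ k → coprime? k 1) x∈ (Coprimality.1-coprimeTo 1) , refl
  p-adic-form (suc m) {x} x∈ with p ∣? x
  ... | no p∤x = suc m , ≤-refl , x , ∈-filter⁺ (λ k → coprime? k (p ^ suc m)) x∈ (∤⇒coprime-p^ {m} p∤x)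
               , sym (trans (cong (λ z → p ^ z * x) (n∸n≡0 m)) (*-identityˡ x))
  ... | yes (divides q refl) with ∈[1⋯]⁻ x∈
  ...   | 0<x , x≤ with p-adic-form m (∈[1⋯]⁺ (>-nonZero⁻¹ q {{m*n≢0⇒m≢0 q {{>-nonZero 0<x}}}}) (*-cancelˡ-≤ p (subst (_≤ p ^ suc m) (*-comm q p) x≤)))
  ...     | i , i≤m , y , y∈ , refl = i , m≤n⇒m≤1+n i≤m , y , y∈ , (begin
    p ^ (m ∸ i) * y * p      ≡⟨ *-comm (p ^ (m ∸ i) * y) p ⟩
    p * (p ^ (m ∸ i) * y)    ≡⟨ *-assoc p (p ^ (m ∸ i)) y ⟨
    p ^ suc (m ∸ i) * y      ≡⟨ cong (λ z → p ^ z * y) (+-∸-assoc 1 i≤m) ⟨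
    p ^ (suc m ∸ i) * y      ∎)
    where open ≡-Reasoning

  -- For i ≤ m these are the points of additive order p^i, that is, those whose gcd with p^m is
  -- p^(m-i). Stratum 0 consists of the point 0.
  stratum : ∀ m .{{_ : NonZero (p ^ m)}} → ℕ → List (Fin (p ^ m))
  stratum m i = map (λ y → (p ^ (m ∸ i) * y) mod (p ^ m)) (totatives (p ^ i))

  length-strata : ∀ m .{{_ : NonZero (p ^ m)}} j → length (concatMap (stratum m) [0⋯ j ]) ≡ p ^ j
  length-strata m zero    = trans (cong length (++-identityʳ (stratum m 0))) (length-map (λ y → (p ^ (m ∸ 0) * y) mod (p ^ m)) (totatives 1))
  length-strata m (suc j) = begin
    length (concatMap (stratum m) [0⋯ suc j ])
      ≡⟨ cong (length ∘ concatMap (stratum m)) (upTo-∷ʳ (suc j)) ⟨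
    length (concatMap (stratum m) ([0⋯ j ] ∷ʳ suc j))
      ≡⟨ cong length (concatMap-++ (stratum m) [0⋯ j ] (suc j ∷ [])) ⟩
    length (concatMap (stratum m) [0⋯ j ] ++ stratum m (suc j) ++ [])
      ≡⟨ length-++ (concatMap (stratum m) [0⋯ j ]) ⟩
    length (concatMap (stratum m) [0⋯ j ]) + length (stratum m (suc j) ++ [])
      ≡⟨ cong₂ _+_ (length-strata m j) (trans (cong length (++-identityʳ (stratum m (suc j)))) (length-map _ (totatives (p ^ suc j)))) ⟩
    p ^ j + φ (p ^ suc j)
      ≡⟨ trans (+-comm (p ^ j) _) (φ[p^1+i]+p^i j) ⟩
    p ^ suc j ∎
    where open ≡-Reasoning

  -- The strata cover all points and have p^m entries altogether, so disjointness follows from the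
  -- count.
  allFin-↭-strata : ∀ m .{{_ : NonZero (p ^ m)}} → allFin (p ^ m) ↭ concatMap (stratum m) [0⋯ m ]
  allFin-↭-strata m = unique-⊆-↭ (Unique.allFin⁺ (p ^ m)) (λ {x} _ → covered x)
    (≤-reflexive (trans (length-strata m m) (sym (length-tabulate {n = p ^ m} (λ i → i)))))
    where
    N = p ^ m
    representative : ∀ x → ∃ λ x′ → x′ ∈ [1⋯ N ] × x′ % N ≡ toℕ {N} x
    representative x with toℕ x | toℕ<n x
    ... | zero   | _   = N , ∈[1⋯]⁺ (>-nonZero⁻¹ N) ≤-refl , n%n≡0 N
    ... | suc x′ | x<N = suc x′ , ∈[1⋯]⁺ z<s (<⇒≤ x<N) , m<n⇒m%n≡m x<N
    covered : ∀ x → x ∈ concatMap (stratum m) [0⋯ m ]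
    covered x with representative x
    ... | x′ , x′∈ , eq with p-adic-form m x′∈
    ...   | i , i≤m , y , y∈ , refl = ∈-concatMap⁺ (stratum m) (lose (∈-upTo⁺ (s≤s i≤m))
      (subst (_∈ stratum m i) (toℕ-injective (trans (toℕ-fromℕ< _) eq))
        (∈-map⁺ (λ y → (p ^ (m ∸ i) * y) mod (p ^ m)) y∈)))

module _ {N : ℕ} .{{_ : NonZero N}} {g : ℕ} (o : HasOrder N g (φ N)) where

  private
    instance _ = φ≢0 N

  g⊥N : Coprime g N
  g⊥N = ≡1⇒coprime N g (trans (cong (λ z → (g ^ z) % N) (suc-pred (φ N))) (o .annihilates))

  g^k⊥N : ∀ k → Coprime (g ^ k) N
  g^k⊥N k = Coprimality.sym (coprime-^ʳ k (Coprimality.sym g⊥N))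

  powers-distinct : ∀ {k l} → k < l → l < φ N + k → (g ^ k) % N ≢ (g ^ l) % N
  powers-distinct {k} {l} k<l l<φ+k eq = >⇒∤ {{>-nonZero (m<n⇒0<n∸m k<l)}}
    (+-cancelʳ-< k (l ∸ k) (φ N) (subst (_< φ N + k) (sym (m∸n+n≡m (<⇒≤ k<l))) l<φ+k))
    (o .minimal (l ∸ k) (%-cancelˡ (g ^ (l ∸ k)) 1 (g^k⊥N k) (begin
      (g ^ k * g ^ (l ∸ k)) % N  ≡⟨ cong (_% N) (^-distribˡ-+-* g k (l ∸ k)) ⟨
      (g ^ (k + (l ∸ k))) % N    ≡⟨ cong (λ z → (g ^ z) % N) (m+[n∸m]≡n (<⇒≤ k<l)) ⟩
      (g ^ l) % N                ≡⟨ eq ⟨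
      (g ^ k) % N                ≡⟨ cong (_% N) (*-identityʳ (g ^ k)) ⟨
      (g ^ k * 1) % N            ∎)))
    where open ≡-Reasoning

  powers-↭-units : map (λ k → (g ^ k) mod N) [1⋯ φ N ] ↭ units N
  powers-↭-units = unique-⊆-↭ unique sub
    (≤-reflexive (trans (units≡totatives N) (sym (trans (length-map _ [1⋯ φ N ]) (length-[1⋯] (φ N))))))
    where
    unique : Unique (map (λ k → (g ^ k) mod N) [1⋯ φ N ])
    unique = subst Unique (sym (trans (cong (map _) (map-applyUpTo (λ i → i) suc (φ N))) (map-applyUpTo suc _ (φ N))))
      (Unique.applyUpTo⁺₁ _ (φ N) λ {i} {j} i<j j<φ eq →
        powers-distinct (s≤s i<j) (≤-trans (s≤s j<φ) (≤-trans (m≤m+n (suc (φ N)) i) (≤-reflexive (sym (+-suc (φ N) i)))))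
          (trans (sym (toℕ-fromℕ< _)) (trans (cong toℕ eq) (toℕ-fromℕ< _))))
    sub : ∀ {a} → a ∈ map (λ k → (g ^ k) mod N) [1⋯ φ N ] → a ∈ units N
    sub a∈ with ∈-map⁻ _ a∈
    ... | k , _ , refl = ∈-filter⁺ (unit? N) (∈-allFin _) (coprime-mod N {g ^ k} (g^k⊥N k))

-- Cycles of a permutation

does-true : ∀ {P : Set} (P? : Dec P) → does P? ≡ true → P
does-true (yes p) _ = p

∣tabulate∣ : {A : Set} {P : Pred A 0ℓ} (P? : Decidable P) → ∀ {n} (f : Fin n → A) →
             ∣ tabulate (λ i → does (P? (f i))) ∣ ≡ count P? (List.tabulate f)
∣tabulate∣ P? {zero}  f = refl
∣tabulate∣ P? {suc n} f with ih ← ∣tabulate∣ P? (f ∘ Fin.suc) | P? (f Fin.zero)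
... | yes _ = cong suc ih
... | no  _ = ih

module _ {N : ℕ} (π : Permutation′ N) where

  ^ₚ-+ : ∀ i j x → _^ₚ_ π (i + j) x ≡ _^ₚ_ π i (_^ₚ_ π j x)
  ^ₚ-+ zero    j x = refl
  ^ₚ-+ (suc i) j x = cong (π ⟨$⟩ʳ_) (^ₚ-+ i j x)

  ^ₚ-injective : ∀ i {x y} → _^ₚ_ π i x ≡ _^ₚ_ π i y → x ≡ y
  ^ₚ-injective zero    eq = eq
  ^ₚ-injective (suc i) eq = ^ₚ-injective i (trans (sym (inverseˡ π)) (trans (cong (π ⟨$⟩ˡ_) eq) (inverseˡ π)))

  record HasPeriod (x : Fin N) (r : ℕ) : Set where
    constructor hasPeriod
    field
      returns : _^ₚ_ π r x ≡ x
      period∣ : ∀ j → _^ₚ_ π j x ≡ x → r ∣ j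

  InCycle : Fin N → Fin N → Set
  InCycle x y = ∃ λ (k : Fin N) → _^ₚ_ π (toℕ k) x ≡ y

  inCycle? : ∀ x → Decidable (InCycle x)
  inCycle? x y = any? {n = N} λ k → (_^ₚ_ π (toℕ k) x) ≟ᶠ y

  module _ {x : Fin N} {r : ℕ} .{{_ : NonZero r}} (per : HasPeriod x r) where
    open HasPeriod per

    private
      orbit = applyUpTo (λ k → _^ₚ_ π k x) r

    ^ₚ-multiple : ∀ q → _^ₚ_ π (q * r) x ≡ x
    ^ₚ-multiple zero    = refl
    ^ₚ-multiple (suc q) = trans (^ₚ-+ r (q * r) x) (trans (cong (_^ₚ_ π r) (^ₚ-multiple q)) returns)

    ^ₚ-% : ∀ k → _^ₚ_ π k x ≡ _^ₚ_ π (k % r) x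
    ^ₚ-% k = trans (cong (λ z → _^ₚ_ π z x) (m≡m%n+[m/n]*n k r))
      (trans (^ₚ-+ (k % r) (k / r * r) x) (cong (_^ₚ_ π (k % r)) (^ₚ-multiple (k / r))))

    orbit-unique : Unique orbit
    orbit-unique = Unique.applyUpTo⁺₁ _ r λ {i} {j} i<j j<r eq →
      >⇒∤ {{>-nonZero (m<n⇒0<n∸m i<j)}} (≤-<-trans (m∸n≤m j i) j<r)
        (period∣ (j ∸ i) (^ₚ-injective i (trans (sym (^ₚ-+ i (j ∸ i) x))
          (trans (cong (λ z → _^ₚ_ π z x) (m+[n∸m]≡n (<⇒≤ i<j))) (sym eq)))))

    -- Ensures that the exponents below `N`, the only ones that `cycleOf` inspects, reach the whole
    -- orbit.
    period≤N : r ≤ N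
    period≤N = subst₂ _≤_ (length-applyUpTo _ r) (length-tabulate {n = N} (λ i → i))
      (unique-⊆-length orbit-unique λ _ → ∈-allFin _)

    inCycle : ∀ k → InCycle x (_^ₚ_ π k x)
    inCycle k = fromℕ< k%r<N , trans (cong (λ z → _^ₚ_ π z x) (toℕ-fromℕ< k%r<N)) (sym (^ₚ-% k))
      where
      k%r<N : k % r < N
      k%r<N = <-≤-trans (m%n<n k r) period≤N

    inCycle-sym : ∀ {y} → InCycle x y → ∃ λ k → x ≡ _^ₚ_ π k y
    -- After k steps, k r - k further steps complete k full periods and return to `x`.
    inCycle-sym (k , refl) = toℕ k * r ∸ toℕ k , (begin
      x                                                     ≡⟨ ^ₚ-multiple (toℕ k) ⟨
      _^ₚ_ π (toℕ k * r) x                                  ≡⟨ cong (λ z → _^ₚ_ π z x) (m∸n+n≡m (m≤m*n (toℕ k) r)) ⟨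
      _^ₚ_ π (toℕ k * r ∸ toℕ k + toℕ k) x                  ≡⟨ ^ₚ-+ (toℕ k * r ∸ toℕ k) (toℕ k) x ⟩
      _^ₚ_ π (toℕ k * r ∸ toℕ k) (_^ₚ_ π (toℕ k) x)         ∎)
      where open ≡-Reasoning

    ∣cycleOf∣ : ∣ cycleOf π x ∣ ≡ r
    ∣cycleOf∣ = trans (∣tabulate∣ (inCycle? x) (λ i → i)) (trans (≤-antisym
      (unique-⊆-length (Unique.filter⁺ (inCycle? x) (Unique.allFin⁺ N)) to)
      (unique-⊆-length orbit-unique from)) (length-applyUpTo _ r))
      where
      to : ∀ {y} → y ∈ filter (inCycle? x) (allFin N) → y ∈ orbit
      to y∈ with ∈-filter⁻ (inCycle? x) {xs = allFin N} y∈
      ... | _ , k , refl = subst (_∈ orbit) (sym (^ₚ-% (toℕ k))) (∈-applyUpTo⁺ _ (m%n<n (toℕ k) r))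
      from : ∀ {y} → y ∈ orbit → y ∈ filter (inCycle? x) (allFin N)
      from y∈ with ∈-applyUpTo⁻ (λ k → _^ₚ_ π k x) y∈
      ... | k , _ , refl = ∈-filter⁺ (inCycle? x) (∈-allFin _) (inCycle k)

  module _ (period : Fin N → ℕ) (period≢0 : ∀ x → NonZero (period x)) (per : ∀ x → HasPeriod x (period x)) where

    private
      _≟ˢ_ = ≡-dec {n = N} Bool._≟_

      inCycle-trans : ∀ {x y z} → InCycle x y → InCycle y z → InCycle x z
      inCycle-trans {x} (k , refl) (l , refl) = subst (InCycle x) (^ₚ-+ (toℕ l) (toℕ k) x) (inCycle {{period≢0 x}} (per x) (toℕ l + toℕ k))

      inCycle-sym′ : ∀ {x y} → InCycle x y → InCycle y x
      inCycle-sym′ {x} {y} x~y with inCycle-sym {{period≢0 x}} (per x) x~y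
      ... | k , eq = subst (InCycle y) (sym eq) (inCycle {{period≢0 y}} (per y) k)

    inCycle⇒cycleOf≡ : ∀ {x y} → InCycle x y → cycleOf π y ≡ cycleOf π x
    inCycle⇒cycleOf≡ {x} {y} x~y = tabulate-cong λ z → does-⇔
      (mk⇔ (inCycle-trans x~y) (inCycle-trans (inCycle-sym′ x~y))) (inCycle? y z) (inCycle? x z)

    cycleOf≡⇒inCycle : ∀ {x y} → cycleOf π y ≡ cycleOf π x → InCycle x y
    cycleOf≡⇒inCycle {x} {y} eq = does-true (inCycle? x y) (begin
      does (inCycle? x y)       ≡⟨ lookup∘tabulate (does ∘ inCycle? x) y ⟨
      lookup (cycleOf π x) y    ≡⟨ cong (λ c → lookup c y) eq ⟨
      lookup (cycleOf π y) y    ≡⟨ lookup∘tabulate (does ∘ inCycle? y) y ⟩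
      does (inCycle? y y)       ≡⟨ dec-true (inCycle? y y) (inCycle {{period≢0 y}} (per y) 0) ⟩
      true                      ∎)
      where open ≡-Reasoning

    ∈-cycles⁻ : ∀ {c} → c ∈ cycles π → ∃ λ x → c ≡ cycleOf π x
    ∈-cycles⁻ c∈ with ∈-map⁻ (cycleOf π) (∈-deduplicate⁻ _≟ˢ_ (map (cycleOf π) (allFin N)) c∈)
    ... | x , _ , eq = x , eq

    -- Both sides count the points lying on cycles of length `l`: each such cycle is the fibre of
    -- `cycleOf` over itself and has `l` points.
    cycleCount-* : ∀ l → cycleCount π l * l ≡ count (λ x → ∣ cycleOf π x ∣ ≟ l) (allFin N)
    cycleCount-* l = trans (sym (count-fibres _≟ˢ_ (cycleOf π) (allFin N)
        (Unique.filter⁺ (λ c → ∣ c ∣ ≟ l) (DecUnique.deduplicate-! _≟ˢ_ (map (cycleOf π) (allFin N)))) fibre))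
      (count-cong _ _ (allFin N)
        (λ _ → proj₂ ∘ ∈-filter⁻ (λ c → ∣ c ∣ ≟ l) {xs = cycles π})
        (λ x∈ → ∈-filter⁺ (λ c → ∣ c ∣ ≟ l) (∈-deduplicate⁺ _≟ˢ_ (∈-map⁺ (cycleOf π) x∈))))
      where
      fibre : ∀ {c} → c ∈ filter (λ c → ∣ c ∣ ≟ l) (cycles π) → count (λ x → cycleOf π x ≟ˢ c) (allFin N) ≡ l
      fibre c∈ with ∈-filter⁻ (λ c → ∣ c ∣ ≟ l) {xs = cycles π} c∈
      ... | c∈ , eq with ∈-cycles⁻ c∈
      ...   | x , refl = trans (count-cong _ (inCycle? x) (allFin N) (λ _ → cycleOf≡⇒inCycle) (λ _ → inCycle⇒cycleOf≡))
                           (trans (sym (∣tabulate∣ (inCycle? x) (λ i → i))) eq)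

    -- `ctype` multiplies over the lengths 1 to N only. As no cycle has another length, the exponent
    -- of x_l in it is `cycleCount π l` for every l.
    cycleCount≡0 : ∀ {l} → l ∉ [1⋯ N ] → cycleCount π l ≡ 0
    cycleCount≡0 {l} l∉ = count-none (λ c → ∣ c ∣ ≟ l) (cycles π) λ { c∈ refl → l∉ (size c∈) }
      where
      size : ∀ {c} → c ∈ cycles π → ∣ c ∣ ∈ [1⋯ N ]
      size {c} c∈ with ∈-cycles⁻ c∈
      ... | x , refl = ∈[1⋯]⁺ (subst (0 <_) (sym (∣cycleOf∣ {{period≢0 x}} (per x))) (>-nonZero⁻¹ _ {{period≢0 x}})) (∣p∣≤n c)

-- Cycle type of a permutation whose period is constant on each stratum

count-replicate-≡ : ∀ e l → count (_≟ l) (replicate e l) ≡ e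
count-replicate-≡ e l = trans (count-all (_≟ l) _ (All.lookup {P = _≡ l} (All.replicate⁺ e refl))) (length-replicate e)

count-replicate-≢ : ∀ e {i l} → i ≢ l → count (_≟ l) (replicate e i) ≡ 0
count-replicate-≢ e {i} {l} i≢l = count-none (_≟ l) _ (All.lookup {P = _≢ l} (All.replicate⁺ e i≢l))

module _ {A : Set} (b : A → ℕ) (e : A → ℕ) where

  count-∏≡0 : ∀ {l} is → (∀ {i} → i ∈ is → b i ≢ l) → count (_≟ l) (∏ is λ i → x[ b i ]^ e i) ≡ 0
  count-∏≡0 []       _  = refl
  count-∏≡0 {l} (i ∷ is) b≢ = trans (count-++ (_≟ l) (x[ b i ]^ e i) (∏ is λ i → x[ b i ]^ e i))
    (cong₂ _+_ (count-replicate-≢ (e i) (b≢ (here refl))) (count-∏≡0 is (b≢ ∘ there)))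

count-∏-x : ∀ (e : ℕ → ℕ) {l is} → Unique is → l ∈ is → count (_≟ l) (∏ is λ i → x[ i ]^ e i) ≡ e l
count-∏-x e {l} {i ∷ is} (i∉ ∷ u) l∈ with count-++ (_≟ l) (x[ i ]^ e i) (∏ is λ i → x[ i ]^ e i) | l∈
... | eq | here refl = trans eq (trans (cong₂ _+_ (count-replicate-≡ (e l) l)
        (count-∏≡0 (λ i → i) e is λ { l∈ refl → All.lookup i∉ l∈ refl })) (+-identityʳ (e l)))
... | eq | there l∈  = trans eq (cong₂ _+_ (count-replicate-≢ (e i) (All.lookup i∉ l∈)) (count-∏-x e u l∈))

module _ {N : ℕ} (π : Permutation′ N) {A : Set} (is : List A) (stratum : A → List (Fin N)) (r e : A → ℕ)
         (r≢0 : ∀ i → NonZero (r i))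
         (strata : allFin N ↭ concatMap stratum is)
         (size : ∀ {i} → i ∈ is → e i * r i ≡ length (stratum i))
         (per : ∀ {i} → i ∈ is → ∀ {x} → x ∈ stratum i → HasPeriod π x (r i)) where

  open import Data.List.Membership.DecPropositional _≟_ using (_∈?_)

  private
    period : ∀ x → ∃ λ i → i ∈ is × x ∈ stratum i
    period x = find (∈-concatMap⁻ stratum (∈-resp-↭ strata (∈-allFin x)))

    period′ : Fin N → ℕ
    period′ x = r (proj₁ (period x))

    per′ : ∀ x → HasPeriod π x (period′ x)
    per′ x = per (proj₁ (proj₂ (period x))) (proj₂ (proj₂ (period x)))

    period′≢0 : ∀ x → NonZero (period′ x)
    period′≢0 x = r≢0 (proj₁ (period x))

    target = ∏ is λ i → x[ r i ]^ e i

    count-target : ∀ l js → (∀ {i} → i ∈ js → i ∈ is) →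
      count (_≟ l) (∏ js λ i → x[ r i ]^ e i) * l ≡ count (λ x → ∣ cycleOf π x ∣ ≟ l) (concatMap stratum js)
    count-target l []       _   = refl
    count-target l (i ∷ js) sub = begin
      count (_≟ l) (x[ r i ]^ e i ++ rest) * l
        ≡⟨ cong (_* l) (count-++ (_≟ l) (x[ r i ]^ e i) rest) ⟩
      (count (_≟ l) (x[ r i ]^ e i) + count (_≟ l) rest) * l
        ≡⟨ *-distribʳ-+ l (count (_≟ l) (x[ r i ]^ e i)) (count (_≟ l) rest) ⟩
      count (_≟ l) (x[ r i ]^ e i) * l + count (_≟ l) rest * l
        ≡⟨ cong₂ _+_ one (count-target l js (sub ∘ there)) ⟩
      count ofSize? (stratum i) + count ofSize? (concatMap stratum js)
        ≡⟨ count-++ ofSize? (stratum i) (concatMap stratum js) ⟨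
      count ofSize? (stratum i ++ concatMap stratum js) ∎
      where
      open ≡-Reasoning
      rest = ∏ js λ i → x[ r i ]^ e i
      ofSize? = λ x → ∣ cycleOf π x ∣ ≟ l
      i∈ = sub (here refl)
      one : count (_≟ l) (x[ r i ]^ e i) * l ≡ count ofSize? (stratum i)
      one with r i ≟ l
      ... | yes refl = trans (cong (_* l) (count-replicate-≡ (e i) l)) (trans (size i∈)
              (sym (count-all ofSize? (stratum i) λ x∈ → ∣cycleOf∣ π {{r≢0 i}} (per i∈ x∈))))
      ... | no  r≢l  = trans (cong (_* l) (count-replicate-≢ (e i) r≢l))
              (sym (count-none ofSize? (stratum i) λ x∈ eq → r≢l (trans (sym (∣cycleOf∣ π {{r≢0 i}} (per i∈ x∈))) eq)))

    count-ctype : ∀ l → count (_≟ l) (ctype π) ≡ cycleCount π l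
    count-ctype l with l ∈? [1⋯ N ]
    ... | yes l∈ = count-∏-x (cycleCount π) ([1⋯]-unique N) l∈
    ... | no  l∉ = trans (count-∏≡0 (λ i → i) (cycleCount π) [1⋯ N ] λ { l∈ refl → l∉ l∈ })
                     (sym (cycleCount≡0 π period′ period′≢0 per′ l∉))

  -- Several strata may share a cycle length, so exponents are compared only after summation:
  -- multiplied by `l`, both count the points on cycles of length `l`.
  ctype-↭ : ctype π ↭ ∏ is λ i → x[ r i ]^ e i
  ctype-↭ = ↭-counts _≟_ (ctype π) target same
    where
    open ≡-Reasoning
    same : ∀ l → count (_≟ l) (ctype π) ≡ count (_≟ l) target
    -- The factor 0 cannot be cancelled; instead, neither monomial contains index 0.
    same zero = trans (count-ctype 0) (trans (cycleCount≡0 π period′ period′≢0 per′ (λ 0∈ → n≮0 (proj₁ (∈[1⋯]⁻ 0∈))))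
             (sym (count-∏≡0 r e is λ {i} _ r≡0 → ≢-nonZero⁻¹ (r i) {{r≢0 i}} r≡0)))
    same l@(suc _) = *-cancelʳ-≡ _ _ l (begin
      count (_≟ l) (ctype π) * l                                  ≡⟨ cong (_* l) (count-ctype l) ⟩
      cycleCount π l * l                                          ≡⟨ cycleCount-* π period′ period′≢0 per′ l ⟩
      count (λ x → ∣ cycleOf π x ∣ ≟ l) (allFin N)                ≡⟨ count-↭ (λ x → ∣ cycleOf π x ∣ ≟ l) strata ⟩
      count (λ x → ∣ cycleOf π x ∣ ≟ l) (concatMap stratum is)    ≡⟨ count-target l is (λ i∈ → i∈) ⟨
      count (_≟ l) target * l                                     ∎)

-- The cycle index

sum-filter : {P : Pred Monomial 0ℓ} (P? : Decidable P) → ∀ c {A : Set} (f : A → Monomial) is →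
             foldr ℚ._+_ 0ℚ (map proj₁ (filter (λ t → P? (proj₂ t)) (c · ∑ is f)))
             ≡ foldr ℚ._+_ 0ℚ (replicate (count (λ i → P? (f i)) is) (c ℚ.* 1ℚ))
sum-filter P? c f []       = refl
sum-filter P? c f (i ∷ is) with ih ← sum-filter P? c f is | P? (f i)
... | yes _ = cong (c ℚ.* 1ℚ ℚ.+_) ih
... | no  _ = ih

coefficient-∑ : ∀ μ c {A : Set} (f : A → Monomial) is →
                coefficient μ (c · ∑ is f) ≡ foldr ℚ._+_ 0ℚ (replicate (count (λ i → f i ↭? μ) is) (c ℚ.* 1ℚ))
coefficient-∑ μ = sum-filter (_↭? μ)

1/-cong : ∀ {m n} .{{_ : NonZero m}} .{{_ : NonZero n}} → m ≡ n → 1/ m ≡ 1/ n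
1/-cong refl = refl

-- On either side all terms carry the same rational factor, so the coefficient of `μ` depends only
-- on how many terms have monomial `μ`.
cycleIndex-≈ : ∀ {N} (G : PermutationGroup N) {A : Set} (M : A → Monomial) (is : List A) {n : ℕ} .{{_ : NonZero n}} →
               PermutationGroup.order G ≡ n →
               (∀ μ → count (λ π → ctype π ↭? μ) (PermutationGroup.elements G) ≡ count (λ i → M i ↭? μ) is) →
               cycleIndex G ≈ 1/ n · ∑ is M
cycleIndex-≈ G M is {n} order≡n counts μ = begin
  coefficient μ (cycleIndex G)
    ≡⟨ coefficient-∑ μ (1/ order) ctype elements ⟩
  foldr ℚ._+_ 0ℚ (replicate (count (λ π → ctype π ↭? μ) elements) (1/ order ℚ.* 1ℚ))
    ≡⟨ cong₂ (λ e c → foldr ℚ._+_ 0ℚ (replicate e (c ℚ.* 1ℚ))) (counts μ) (1/-cong order≡n) ⟩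
  foldr ℚ._+_ 0ℚ (replicate (count (λ i → M i ↭? μ) is) (1/ n ℚ.* 1ℚ))
    ≡⟨ coefficient-∑ μ (1/ n) M is ⟨
  coefficient μ (1/ n · ∑ is M) ∎
  where
  open ≡-Reasoning
  open PermutationGroup G

-- Passage from units with coprimality proofs to exponents of g

length-reduce : ∀ {A B : Set} {P : Pred A 0ℓ} {f : ∀ {a} → P a → B} {as} (pas : All P as) →
                length (All.reduce f pas) ≡ length as
length-reduce []         = refl
length-reduce {f = f} (_ ∷ pas) = cong suc (length-reduce {f = f} pas)

count-reduce : ∀ {A B : Set} {P Q : Pred A 0ℓ} {R : Pred B 0ℓ} (Q? : Decidable Q) (R? : Decidable R)
               {f : ∀ {a} → P a → B} {as} (pas : All P as) →
               (∀ {a} → a ∈ as → (p : P a) → Q a → R (f p)) → (∀ {a} → a ∈ as → (p : P a) → R (f p) → Q a) →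
               count R? (All.reduce f pas) ≡ count Q? as
count-reduce Q? R? [] _ _ = refl
count-reduce Q? R? {f} {a ∷ as} (p ∷ pas) to from
  with ih ← count-reduce Q? R? {f} pas (to ∘ there) (from ∘ there) | Q? a | R? (f p)
... | yes _ | yes _ = cong suc ih
... | yes q | no ¬r = contradiction (to (here refl) p q) ¬r
... | no ¬q | yes r = contradiction (from (here refl) p r) ¬q
... | no  _ | no  _ = ih

module _ {A B K : Set} {P : Pred A 0ℓ} (P? : Decidable P) (f : ∀ {a} → P a → B)
         (h : B → Monomial) (M : K → Monomial) (e : K → A)
         {as : List A} {ks : List K} (ks↭as : map e ks ↭ as) (pas : All P as)
         (h-f : ∀ {k} (pₖ : P (e k)) → h (f pₖ) ↭ M k)
         {Q : Pred Monomial 0ℓ} (Q? : Decidable Q) (Q-resp : ∀ {μ ν} → μ ↭ ν → Q μ → Q ν) where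

  private
    -- `f` takes a proof of `P a`, not just `a`. Deciding `P a` afresh gives a function of `a`
    -- alone, along which counts can be moved; on `as` the default `[]` does not occur, because `P`
    -- holds there.
    valueIf : ∀ {a} → Dec (P a) → Monomial
    valueIf (yes p) = h (f p)
    valueIf (no  _) = []

    value : A → Monomial
    value a = valueIf (P? a)

    value-e : ∀ {k} → k ∈ ks → value (e k) ↭ M k
    value-e {k} k∈ with P? (e k)
    ... | yes p = h-f p
    ... | no ¬p = contradiction (All.lookup pas (∈-resp-↭ ks↭as (∈-map⁺ e k∈))) ¬p

    value-f : ∀ {a} → a ∈ as → (p : P a) → value a ↭ h (f p)
    value-f a∈ p with ∈-map⁻ e (∈-resp-↭ (↭-sym ks↭as) a∈)
    ... | k , k∈ , refl = ↭-trans (value-e k∈) (↭-sym (h-f p))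

  count-reindex : count (λ b → Q? (h b)) (All.reduce f pas) ≡ count (λ k → Q? (M k)) ks
  count-reindex = begin
    count (λ b → Q? (h b)) (All.reduce f pas)
      ≡⟨ count-reduce (λ a → Q? (value a)) (λ b → Q? (h b)) pas
           (λ a∈ p → Q-resp (value-f a∈ p)) (λ a∈ p → Q-resp (↭-sym (value-f a∈ p))) ⟩
    count (λ a → Q? (value a)) as
      ≡⟨ count-↭ (λ a → Q? (value a)) ks↭as ⟨
    count (λ a → Q? (value a)) (map e ks)
      ≡⟨ count-map (λ k → Q? (M k)) (λ a → Q? (value a)) e ks
           (λ k∈ → Q-resp (↭-sym (value-e k∈))) (λ k∈ → Q-resp (value-e k∈)) ⟩
    count (λ k → Q? (M k)) ks ∎
    where open ≡-Reasoning

-- Periods of points under multiplication, and the cycle index of the unit group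

module _ {N : ℕ} .{{_ : NonZero N}} {π : Permutation′ N} {a : ℕ} (π≗mul : ∀ x → π ⟨$⟩ʳ x ≡ mul N a x) where

  ^ₚ-mul : ∀ j x → _^ₚ_ π j x ≡ mul N (a ^ j) x
  ^ₚ-mul zero    x = sym (mul-1 N x)
  ^ₚ-mul (suc j) x = begin
    π ⟨$⟩ʳ (_^ₚ_ π j x)       ≡⟨ π≗mul (_^ₚ_ π j x) ⟩
    mul N a (_^ₚ_ π j x)      ≡⟨ cong (mul N a) (^ₚ-mul j x) ⟩
    mul N a (mul N (a ^ j) x) ≡⟨ mul-∘ N a (a ^ j) x ⟩
    mul N (a ^ suc j) x       ∎
    where open ≡-Reasoning

  -- A factor b fixes c y modulo c n exactly if y b ≡ y modulo n, and as y is coprime to n, exactly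
  -- if b ≡ 1 modulo n. With b = a^j the period is the order of `a` modulo `n`.
  hasPeriod-mul : ∀ {c n y d} .{{_ : NonZero n}} → N ≡ c * n → Coprime y n → HasOrder n a d →
                  HasPeriod π ((c * y) mod N) d
  hasPeriod-mul {c} {n} {y} {d} N≡c*n y⊥n o = hasPeriod
    (toℕ-injective (trans (toℕ-^ₚ d) (trans (from (o .annihilates)) (sym (toℕ-fromℕ< _)))))
    (λ j eq → o .minimal j (to (trans (sym (toℕ-^ₚ j)) (trans (cong toℕ eq) (toℕ-fromℕ< _)))))
    where
    open ≡-Reasoning
    instance
      c≢0 : NonZero c
      c≢0 = m*n≢0⇒m≢0 c {n} {{subst NonZero N≡c*n (≢-nonZero (≢-nonZero⁻¹ N))}}
    x = (c * y) mod N
    rearrange : ∀ b → b * (c * y) ≡ c * (y * b)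
    rearrange b = trans (*-comm b (c * y)) (*-assoc c y b)
    toℕ-^ₚ : ∀ j → toℕ (_^ₚ_ π j x) ≡ (a ^ j * (c * y)) % N
    toℕ-^ₚ j = begin
      toℕ (_^ₚ_ π j x)            ≡⟨ cong toℕ (^ₚ-mul j x) ⟩
      toℕ (mul N (a ^ j) x)       ≡⟨ toℕ-mul N (a ^ j) x ⟩
      (a ^ j * toℕ x) % N         ≡⟨ cong (λ z → (a ^ j * z) % N) (toℕ-fromℕ< _) ⟩
      (a ^ j * ((c * y) % N)) % N ≡⟨ %-*ʳ N (a ^ j) (c * y) ⟩
      (a ^ j * (c * y)) % N       ∎
    diff : ∀ b → ∣ b * (c * y) - c * y ∣ ≡ c * ∣ y * b - y * 1 ∣
    diff b = trans (cong₂ ∣_-_∣ (rearrange b) (cong (c *_) (sym (*-identityʳ y)))) (sym (*-distribˡ-∣-∣ c (y * b) (y * 1)))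
    to : ∀ {b} → (b * (c * y)) % N ≡ (c * y) % N → b % n ≡ 1 % n
    to {b} eq = %-cancelˡ b 1 y⊥n (∣⇒%≡ (y * b) (y * 1)
      (*-cancelˡ-∣ c (subst₂ _∣_ N≡c*n (diff b) (%≡⇒∣ (b * (c * y)) (c * y) eq))))
    from : ∀ {b} → b % n ≡ 1 % n → (b * (c * y)) % N ≡ (c * y) % N
    from {b} eq = ∣⇒%≡ (b * (c * y)) (c * y) (subst₂ _∣_ (sym N≡c*n) (sym (diff b))
      (*-monoʳ-∣ c (%≡⇒∣ (y * b) (y * 1) (%-cong-* {n} {y} {y} {b} {1} refl eq))))

primitive-root-φ : ∀ {p} (p-prime : Prime p) → 2 ∤ p → ∀ m →
                   ∃ λ g → ∀ {i} .{{_ : NonZero (p ^ i)}} → i ≤ suc m → HasOrder (p ^ i) g (φ (p ^ i))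
primitive-root-φ {p} p-prime p-odd m = g , order
  where
  g  = proj₁ (primitive-root p-prime p-odd m)
  og = proj₂ (primitive-root p-prime p-odd m)
  order : ∀ {i} .{{_ : NonZero (p ^ i)}} → i ≤ suc m → HasOrder (p ^ i) g (φ (p ^ i))
  -- Modulo p^0 = 1 every exponent annihilates g, so the order is 1 = φ(1); this is the case of the
  -- fixed point 0.
  order {zero}  _         = hasOrder (trans (n%1≡0 (g ^ 1)) (sym (n%1≡0 1))) λ k _ → 1∣ k
  order {suc i} (s≤s i≤m) = subst (HasOrder (p ^ suc i) g) (sym (φ[p^1+i] p-prime i)) (og {i} i≤m)

module _ {p : ℕ} (p-prime : Prime p) where

  private
    instance
      p≢0 : NonZero p
      p≢0 = prime⇒nonZero p-prime

  module _ {m g : ℕ} .{{_ : NonZero (p ^ m)}} (og : ∀ {i} .{{_ : NonZero (p ^ i)}} → i ≤ m → HasOrder (p ^ i) g (φ (p ^ i))) where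

    private
      N = p ^ m

      power : ℕ → Fin N
      power k = (g ^ k) mod N

      monomial : ℕ → Monomial
      monomial k = ∏ [0⋯ m ] λ i → x[ u p-prime i k ]^ v p-prime i k

    u≢0 : ∀ i k → NonZero (u p-prime i k)
    u≢0 i k = ≢-nonZero λ u≡0 → ≢-nonZero⁻¹ (φ (p ^ i)) {{φ[p^ p-prime ]≢0 i}}
      (trans (sym (m/n*n≡m {{v≢0 p-prime i k}} (gcd[m,n]∣m (φ (p ^ i)) k))) (cong (_* v p-prime i k) u≡0))

    ctype-mul : ∀ k {π : Permutation′ N} → (∀ x → π ⟨$⟩ʳ x ≡ mul N (g ^ k) x) → ctype π ↭ monomial k
    ctype-mul k {π} π≗mul = ctype-↭ π [0⋯ m ] (stratum p-prime m) (λ i → u p-prime i k) (λ i → v p-prime i k)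
      (λ i → u≢0 i k) (allFin-↭-strata p-prime m) size period
      where
      size : ∀ {i} → i ∈ [0⋯ m ] → v p-prime i k * u p-prime i k ≡ length (stratum p-prime m i)
      size {i} _ = trans (m*[n/m]≡n {{v≢0 p-prime i k}} (gcd[m,n]∣m (φ (p ^ i)) k)) (sym (length-map _ (totatives (p ^ i))))

      period-point : ∀ {i y} → i ≤ m → y ∈ totatives (p ^ i) → HasPeriod π ((p ^ (m ∸ i) * y) mod N) (u p-prime i k)
      period-point {i} i≤m y∈ = hasPeriod-mul π≗mul {p ^ (m ∸ i)}
        (trans (cong (p ^_) (sym (m∸n+n≡m i≤m))) (^-distribˡ-+-* p (m ∸ i) i))
        (proj₂ (∈-filter⁻ (λ k → coprime? k (p ^ i)) {xs = [1⋯ p ^ i ]} y∈))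
        (hasOrder-^ k (og i≤m) {{v≢0 p-prime i k}})
        where
        instance
          p^i≢0 : NonZero (p ^ i)
          p^i≢0 = m^n≢0 p i

      period : ∀ {i} → i ∈ [0⋯ m ] → ∀ {x} → x ∈ stratum p-prime m i → HasPeriod π x (u p-prime i k)
      period {i} i∈ x∈ =
        let (_ , y∈ , x≡) = ∈-map⁻ (λ y → (p ^ (m ∸ i) * y) mod N) x∈
        in subst (λ x → HasPeriod π x (u p-prime i k)) (sym x≡) (period-point (s≤s⁻¹ (∈-upTo⁻ i∈)) y∈)

    power-↭ : map power [1⋯ φ N ] ↭ units N
    power-↭ = powers-↭-units (og ≤-refl)

    count-ctypes : (ρ : ∀ {a} → Coprime (toℕ a) N → Permutation′ N) →
                   (∀ {a} (c : Coprime (toℕ a) N) x → ρ {a} c ⟨$⟩ʳ x ≡ mul N (toℕ a) x) →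
                   ∀ μ {as} → map power [1⋯ φ N ] ↭ as → (cs : All (λ a → Coprime (toℕ a) N) as) →
                   count (λ π → ctype π ↭? μ) (All.reduce ρ cs) ≡ count (λ k → monomial k ↭? μ) [1⋯ φ N ]
    count-ctypes ρ ρ≗mul μ powers↭ cs = count-reindex (unit? N) ρ ctype monomial power powers↭ cs
      (λ {k} c → ctype-mul k (λ x → trans (ρ≗mul c x) (mul-cong N (toℕ% N (g ^ k)) x)))
      (_↭? μ) (λ μ↭ν → ↭-trans (↭-sym μ↭ν))

    count-unitMaps : ∀ μ → count (λ π → ctype π ↭? μ) (unitMaps N) ≡ count (λ k → monomial k ↭? μ) [1⋯ φ N ]
    -- Writing π[_] for the first _ would trigger a field-by-field (η) comparison
    -- of permutations that does not finish in practice.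
    count-unitMaps μ = count-ctypes _ (λ _ _ → refl) μ power-↭ (all-filter (unit? N) (allFin N))

    cycleIndex-𝒰 : cycleIndex (𝒰 N) ≈ 1/ (φ N) {{φ[p^ p-prime ]≢0 m}} · ∑ [1⋯ φ N ] monomial
    cycleIndex-𝒰 = cycleIndex-≈ (𝒰 N) monomial [1⋯ φ N ] {{φ[p^ p-prime ]≢0 m}}
      (trans (length-reduce (all-filter (unit? N) (allFin N))) (units≡totatives N)) count-unitMaps

lemma4p5 : ∀ (p m : ℕ) (pr : Prime p) → ¬ (2 ∣ p) → 1 ≤ m →
    cycleIndex (𝒰 (p ^ m) {{prime^≢0 pr m}}) ≈
    1/ (φ (p ^ m)) {{φ[p^ pr ]≢0 m}} ·
    ∑ [1⋯ φ (p ^ m) ] (λ k → ∏ [0⋯ m ] (λ i → x[ u pr i k ]^ v pr i k))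
lemma4p5 p (suc m) pr odd _ = cycleIndex-𝒰 pr {{prime^≢0 pr (suc m)}} (proj₂ (primitive-root-φ pr odd m))
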